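{- For integers $k,n>0$, $$(-1)^k\left(\sigma\,\mathrm{mex}(n)+2\sum_{j=1}^{k}(-1)^j\,\sigma\,\mathrm{mex}(n-j^2)-\delta'(n)\right)=\sum_{j=-\infty}^{\infty}(-1)^j\,\overline{M}_k\big(n-j(3j-1)\big).$$
   Context: For a partition $\lambda$, $\mathrm{mex}(\lambda)$ is the smallest positive integer that is not a part of $\lambda$ (the empty partition has mex $1$). For an integer $m\geqslant 0$, $\sigma\,\mathrm{mex}(m)$ is the sum of $\mathrm{mex}(\lambda)$ over all partitions $\lambda$ of $m$; $\sigma\,\mathrm{mex}(m)=0$ for $m<0$. $\delta'(n)=(-1)^m$ if $n=m(3m-1)$ for some integer $m$, and $\delta'(n)=0$ otherwise. An overpartition is a partition in which the first occurrence of each distinct part value may be overlined or not. $\overline{M}_k(m)$ is the number of overpartitions of $m$ in which the first (i.e. smallest) part larger than $k$ appears at least $k+1$ times (such a part must exist); $\overline{M}_k(m)=0$ for $m<0$. -}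

module Defs where

open import Data.Bool using (Bool; true; false; if_then_else_; _∧_)
open import Data.Nat as ℕ using (ℕ; zero; suc; _≡ᵇ_; _≤ᵇ_)
open import Data.Integer as ℤ using (ℤ; +_; -[1+_]; ∣_∣)
open import Data.List using (List; []; _∷_; map; concatMap; upTo; filterᵇ; length; foldr)
open import Data.Vec using (Vec; []; _∷_)
open import Data.Integer.Properties using () renaming (_≟_ to _≟ℤ_)
open import Relation.Nullary.Decidable using (⌊_⌋)

-- Encoding of partitions.
-- A partition of m is encoded by its multiplicity vector
--   c = (c_1, ..., c_m) : Vec ℕ m ,  c_i = number of times part i occurs,
-- subject to  1*c_1 + 2*c_2 + ... + m*c_m = m.
-- (Every part of a partition of m is in {1,...,m}, so this is a bijection.)

box : (l b : ℕ) → List (Vec ℕ l)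
box zero    b = [] ∷ []
box (suc l) b = concatMap (λ x → map (x ∷_) (box l b)) (upTo (suc b))

wt : {l : ℕ} → ℕ → Vec ℕ l → ℕ
wt s []       = 0
wt s (x ∷ xs) = s ℕ.* x ℕ.+ wt (suc s) xs

partitions : (m : ℕ) → List (Vec ℕ m)
partitions m = filterᵇ (λ c → wt 1 c ≡ᵇ m) (box m m)

mexFrom : {l : ℕ} → ℕ → Vec ℕ l → ℕ
mexFrom s []          = s
mexFrom s (zero ∷ xs)  = s
mexFrom s (suc _ ∷ xs) = mexFrom (suc s) xs

mex : {l : ℕ} → Vec ℕ l → ℕ
mex c = mexFrom 1 c

sumℕ : List ℕ → ℕ
sumℕ = foldr ℕ._+_ 0

σmex : ℕ → ℕ
σmex m = sumℕ (map mex (partitions m))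

σmexℤ : ℤ → ℤ
σmexℤ (+ m)    = + σmex m
σmexℤ -[1+ _ ] = + 0

-- Overpartitions of m: a partition c together with a vector of flags
-- o = (o_1,...,o_m) : Vec Bool m, where o_i = true means the first
-- occurrence of part i is overlined; o_i must be false when c_i = 0.

bools : (l : ℕ) → List (Vec Bool l)
bools zero    = [] ∷ []
bools (suc l) = concatMap (λ b → map (b ∷_) (bools l)) (true ∷ false ∷ [])

compatible : {l : ℕ} → Vec ℕ l → Vec Bool l → Bool
compatible []           []           = true
compatible (zero ∷ cs)  (true ∷ os)  = false
compatible (zero ∷ cs)  (false ∷ os) = compatible cs os
compatible (suc _ ∷ cs) (_ ∷ os)     = compatible cs os

record OverPartition (m : ℕ) : Set where
  constructor op
  field
    mult  : Vec ℕ m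
    flags : Vec Bool m

overpartitions : (m : ℕ) → List (OverPartition m)
overpartitions m =
  concatMap (λ c → map (op c) (filterᵇ (compatible c) (bools m))) (partitions m)

firstAboveCond : {l : ℕ} → (k s : ℕ) → Vec ℕ l → Bool
firstAboveCond k s []       = false
firstAboveCond k s (x ∷ xs) =
  if (s ≤ᵇ k) then firstAboveCond k (suc s) xs
  else (if (x ≡ᵇ 0) then firstAboveCond k (suc s) xs else (suc k ≤ᵇ x))

Mcond : {m : ℕ} → ℕ → OverPartition m → Bool
Mcond k p = firstAboveCond k 1 (OverPartition.mult p)

Mbar : ℕ → ℕ → ℕ
Mbar k m = length (filterᵇ (Mcond k) (overpartitions m))

Mbarℤ : ℕ → ℤ → ℤ
Mbarℤ k (+ m)    = + Mbar k m
Mbarℤ k -[1+ _ ] = + 0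

sumℤ : List ℤ → ℤ
sumℤ = foldr ℤ._+_ (+ 0)

sgn : ℤ → ℤ
sgn j = ℤ.-1ℤ ℤ.^ ∣ j ∣

sum1to : ℕ → (ℕ → ℤ) → ℤ
sum1to k f = sumℤ (map (λ i → f (suc i)) (upTo k))

sumSym : ℕ → (ℤ → ℤ) → ℤ
sumSym B f = sumℤ (map (λ i → f (+ i ℤ.- + B)) (upTo (suc (B ℕ.+ B))))

pent2 : ℤ → ℤ
pent2 j = j ℤ.* (+ 3 ℤ.* j ℤ.- + 1)

-- δ'(n) = (-1)^m if n = m(3m-1) for some integer m, 0 otherwise.
-- Any such m satisfies |m| ≤ n, and m ↦ m(3m-1) is injective on ℤ, so the
-- following search over |m| ≤ n finds the (unique) m if it exists.
δ' : ℕ → ℤ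
δ' n = sumSym n (λ m → if ⌊ pent2 m ≟ℤ + n ⌋ then sgn m else + 0)

module Submission where

-- Let D = ∏(1 - q²ⁱ) and G = ∏(1 + qⁱ)/(1 - qⁱ), the generating function of overpartitions.
-- Counting, for each m, the partitions that contain 1, …, m gives Σ σmex(n) qⁿ = Σₘ q^(m(m+1)/2) / ∏(1 - qⁱ),
-- and Gauss's product for Σₘ q^(m(m+1)/2) turns this into D G.  Splitting overpartitions at their first part s > k,
-- the sum over s telescopes and yields M̄ₖ + M̄ₖ₋₁ = 2 q^(k²) G for k > 0, while M̄₀ = G - 1; hence
-- (-1)ᵏ M̄ₖ = G (1 + 2 Σ_{j≤k} (-1)ʲ q^(j²)) - 1.  Multiply by D and expand D = Σⱼ (-1)ʲ q^(j(3j-1)).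
-- Gauss's product and the expansion of D are limits of finite identities of Shanks, proved by telescoping.

open import Defs

-- Every identity is a congruence modulo q^(N+1) for an arbitrary N, so infinite products become
-- finite ones and their denominators become units. A box with m part sizes enumerates the
-- partitions of m only through its coefficient of q^m. Each box identity is therefore used modulo
-- q^(m+1) for its own m, and its products are then lengthened to a common N. The telescoping over s
-- depends on adding M̄ₖ₋₁ to M̄ₖ. For M̄ₖ the part k is still free and gives (1 + q^k)/(1 - q^k);
-- for M̄ₖ₋₁ it can already be the first large part. Over the common factor 1/(1 - q^k), the
-- contributions of first parts s > k thus get the weights 1 + q^k and 1 - q^k, and with exactly
-- these weights each summand is a difference of consecutive tails.

module QSeries where
  open import Algebra.Bundles using (CommutativeRing)
  open import Algebra.Solver.Ring.AlmostCommutativeRing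
    using (fromCommutativeRing; _-Raw-AlmostCommutative⟶_)
  open import Algebra.Structures using (IsCommutativeRing)
  open import Data.Bool using (Bool; true; false; T; if_then_else_)
  open import Data.Bool.Properties using (T-≡)
  import Data.Integer as ℤ
  import Data.Integer.Properties as ℤₚ
  open import Data.Integer.Tactic.RingSolver using () renaming (solve-∀ to ℤ-solve-∀)
  open import Data.List using (List; []; _∷_; _++_; map; concatMap; applyUpTo; upTo; filterᵇ; length)
  open import Data.Maybe as Maybe using (Maybe)
  open import Data.Nat
  open import Data.Nat.Properties
  open import Data.Nat.Tactic.RingSolver using (solve-∀)
  open import Data.Product using (_,_)
  open import Data.Sum using (inj₁; inj₂)
  open import Data.Vec using (Vec; []; _∷_)
  open import Function using (_∘_; id; module Equivalence)
  open import Level using (0ℓ)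
  open import Relation.Binary.PropositionalEquality as ≡ using (_≡_; refl; cong; cong₂)
  open import Relation.Nullary using (yes; no; contradiction)
  open import Relation.Nullary.Decidable using (⌊_⌋; dec⇒maybe)
  open ℤ using (ℤ)

  -- Power series truncated at a fixed degree, as a commutative ring.

  Series : Set
  Series = ℕ → ℤ

  infixl 6 _⊕_ _⊖_
  infixl 7 _⊗_
  infix  8 ⊝_

  private
    -- The Cauchy product by structural recursion on the index: the constant term of `f` is split
    -- off and the rest of `f` is shifted down.
    conv : Series → Series → Series
    conv f g zero    = f 0 ℤ.* g 0
    conv f g (suc n) = f 0 ℤ.* g (suc n) ℤ.+ conv (f ∘ suc) g n

  -- Opaque, so that the ring solver compares its normal forms without unfolding the convolution.
  opaque
    _⊕_ _⊗_ : Series → Series → Series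
    (f ⊕ g) n = f n ℤ.+ g n
    _⊗_ = conv

    ⊝_ : Series → Series
    (⊝ f) n = ℤ.- f n

    C : ℤ → Series
    C z zero    = z
    C z (suc _) = ℤ.0ℤ

    X : ℕ → Series
    X zero    zero    = ℤ.1ℤ
    X zero    (suc _) = ℤ.0ℤ
    X (suc _) zero    = ℤ.0ℤ
    X (suc a) (suc n) = X a n

  _⊖_ : Series → Series → Series
  f ⊖ g = f ⊕ ⊝ g

  opaque
    unfolding _⊕_

    coeff-⊕ : ∀ f g n → (f ⊕ g) n ≡ f n ℤ.+ g n
    coeff-⊕ f g n = refl

    coeff-⊝ : ∀ f n → (⊝ f) n ≡ ℤ.- f n
    coeff-⊝ f n = refl

    coeff-C0 : ∀ n → C ℤ.0ℤ n ≡ ℤ.0ℤ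
    coeff-C0 zero    = refl
    coeff-C0 (suc n) = refl

    coeff-X : ∀ a n → X a n ≡ (if a ≡ᵇ n then ℤ.1ℤ else ℤ.0ℤ)
    coeff-X zero    zero    = refl
    coeff-X zero    (suc n) = refl
    coeff-X (suc a) zero    = refl
    coeff-X (suc a) (suc n) = coeff-X a n

    coeff-X< : ∀ {a n} → n < a → X a n ≡ ℤ.0ℤ
    coeff-X< {suc a} {zero}  _         = refl
    coeff-X< {suc a} {suc n} (s≤s n<a) = coeff-X< n<a

    X0≗1 : ∀ n → X 0 n ≡ C ℤ.1ℤ n
    X0≗1 zero    = refl
    X0≗1 (suc n) = refl

    conv-zeroˡ : ∀ f → (∀ n → f n ≡ ℤ.0ℤ) → ∀ g n → conv f g n ≡ ℤ.0ℤ
    conv-zeroˡ f f≗0 g zero    rewrite f≗0 0 = refl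
    conv-zeroˡ f f≗0 g (suc n) rewrite f≗0 0 | conv-zeroˡ (f ∘ suc) (f≗0 ∘ suc) g n = refl

    coeff-C⊗ : ∀ z g n → (C z ⊗ g) n ≡ z ℤ.* g n
    coeff-C⊗ z g zero    = refl
    coeff-C⊗ z g (suc n) rewrite conv-zeroˡ (C z ∘ suc) (λ _ → refl) g n = ℤₚ.+-identityʳ _

    coeff-X⊗-≥ : ∀ a g n → (X a ⊗ g) (a + n) ≡ g n
    coeff-X⊗-≥ zero    g zero    = ℤₚ.*-identityˡ _
    coeff-X⊗-≥ zero    g (suc n) rewrite conv-zeroˡ (X 0 ∘ suc) (λ _ → refl) g n =
      ≡.trans (ℤₚ.+-identityʳ _) (ℤₚ.*-identityˡ _)
    coeff-X⊗-≥ (suc a) g n       = ≡.trans (ℤₚ.+-identityˡ _) (coeff-X⊗-≥ a g n)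

    coeff-X⊗-< : ∀ a g {n} → n < a → (X a ⊗ g) n ≡ ℤ.0ℤ
    coeff-X⊗-< (suc a) g {zero}  _         = refl
    coeff-X⊗-< (suc a) g {suc n} (s≤s n<a) = ≡.trans (ℤₚ.+-identityˡ _) (coeff-X⊗-< a g n<a)

    coeff-X+ : ∀ a b n → X b n ≡ X (a + b) (a + n)
    coeff-X+ zero    b n = refl
    coeff-X+ (suc a) b n = coeff-X+ a b n


    conv-cong : ∀ {f f′ g g′} n → (∀ {i} → i ≤ n → f i ≡ f′ i) → (∀ {i} → i ≤ n → g i ≡ g′ i) →
                conv f g n ≡ conv f′ g′ n
    conv-cong zero    p r = cong₂ ℤ._*_ (p z≤n) (r z≤n)
    conv-cong (suc n) p r =
      cong₂ ℤ._+_ (cong₂ ℤ._*_ (p z≤n) (r ≤-refl))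
                  (conv-cong n (λ i≤n → p (s≤s i≤n)) (λ i≤n → r (m≤n⇒m≤1+n i≤n)))

    conv-distribʳ : ∀ h f g n → conv (f ⊕ g) h n ≡ conv f h n ℤ.+ conv g h n
    conv-distribʳ h f g zero    = ℤₚ.*-distribʳ-+ (h 0) (f 0) (g 0)
    conv-distribʳ h f g (suc n) =
      ≡.trans (cong (ℤ._+_ ((f 0 ℤ.+ g 0) ℤ.* h (suc n))) (conv-distribʳ h (f ∘ suc) (g ∘ suc) n))
        (lemma (f 0) (g 0) (h (suc n)) (conv (f ∘ suc) h n) (conv (g ∘ suc) h n))
      where
      lemma : ∀ a b c d e → (a ℤ.+ b) ℤ.* c ℤ.+ (d ℤ.+ e) ≡ (a ℤ.* c ℤ.+ d) ℤ.+ (b ℤ.* c ℤ.+ e)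
      lemma = ℤ-solve-∀

    conv-scale : ∀ z f g n → conv (λ i → z ℤ.* f i) g n ≡ z ℤ.* conv f g n
    conv-scale z f g zero    = ℤₚ.*-assoc z (f 0) (g 0)
    conv-scale z f g (suc n) =
      ≡.trans (cong (ℤ._+_ (z ℤ.* f 0 ℤ.* g (suc n))) (conv-scale z (f ∘ suc) g n))
        (lemma z (f 0) (g (suc n)) (conv (f ∘ suc) g n))
      where
      lemma : ∀ z a b c → z ℤ.* a ℤ.* b ℤ.+ z ℤ.* c ≡ z ℤ.* (a ℤ.* b ℤ.+ c)
      lemma = ℤ-solve-∀

    -- Peels the product at the end opposite to the one that the definition peels. Commutativity is
    -- the comparison of these two recursions.
    conv-last : ∀ f g n → conv f g (suc n) ≡ conv f (g ∘ suc) n ℤ.+ f (suc n) ℤ.* g 0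
    conv-last f g zero    = refl
    conv-last f g (suc n) =
      ≡.trans (cong (ℤ._+_ (f 0 ℤ.* g (suc (suc n)))) (conv-last (f ∘ suc) g n))
        (≡.sym (ℤₚ.+-assoc (f 0 ℤ.* g (suc (suc n))) _ _))

    conv-comm : ∀ f g n → conv f g n ≡ conv g f n
    conv-comm f g zero    = ℤₚ.*-comm (f 0) (g 0)
    conv-comm f g (suc n) =
      ≡.trans (cong₂ ℤ._+_ (ℤₚ.*-comm (f 0) (g (suc n))) (conv-comm (f ∘ suc) g n))
        (≡.trans (ℤₚ.+-comm (g (suc n) ℤ.* f 0) (conv g (f ∘ suc) n)) (≡.sym (conv-last g f n)))

    conv-assoc : ∀ f g h n → conv (conv f g) h n ≡ conv f (conv g h) n
    conv-assoc f g h zero    = ℤₚ.*-assoc (f 0) (g 0) (h 0)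
    conv-assoc f g h (suc n) =
      ≡.trans (cong (ℤ._+_ (f 0 ℤ.* g 0 ℤ.* h (suc n)))
        (≡.trans (conv-distribʳ h (λ i → f 0 ℤ.* g (suc i)) (conv (f ∘ suc) g) n)
          (cong₂ ℤ._+_ (conv-scale (f 0) (g ∘ suc) h n) (conv-assoc (f ∘ suc) g h n))))
        (lemma (f 0) (g 0) (h (suc n)) (conv (g ∘ suc) h n) (conv (f ∘ suc) (conv g h) n))
      where
      lemma : ∀ a b c d e → a ℤ.* b ℤ.* c ℤ.+ (a ℤ.* d ℤ.+ e) ≡ a ℤ.* (b ℤ.* c ℤ.+ d) ℤ.+ e
      lemma = ℤ-solve-∀

  -- ℤ[[q]] / (q^(N+1)).
  module Trunc (N : ℕ) where

    infix 4 _≈_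

    -- A record rather than a bare pointwise statement, so that both series can be inferred from the
    -- type of a congruence.
    record _≈_ (f g : Series) : Set where
      constructor mk
      field at : ∀ {i} → i ≤ N → f i ≡ g i
    open _≈_ public

    pointwise : ∀ {f g} → (∀ n → f n ≡ g n) → f ≈ g
    pointwise p = mk λ {i} _ → p i

    opaque
      unfolding _⊕_

      isCommutativeRing : IsCommutativeRing _≈_ _⊕_ _⊗_ ⊝_ (C ℤ.0ℤ) (C ℤ.1ℤ)
      isCommutativeRing = record
          { isRing = record
            { +-isAbelianGroup = record
              { isGroup = record
                { isMonoid = record
                  { isSemigroup = record
                    { isMagma = record
                      { isEquivalence = record
                        { refl  = mk λ _ → refl
                        ; sym   = λ p → mk λ i≤N → ≡.sym (at p i≤N)
                        ; trans = λ p r → mk λ i≤N → ≡.trans (at p i≤N) (at r i≤N)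
                        }
                      ; ∙-cong = λ p r → mk λ i≤N → cong₂ ℤ._+_ (at p i≤N) (at r i≤N)
                      }
                    ; assoc = λ f g h → pointwise λ n → ℤₚ.+-assoc (f n) (g n) (h n)
                    }
                  ; identity = (λ f → pointwise λ n → ≡.trans (cong (ℤ._+ f n) (coeff-C0 n)) (ℤₚ.+-identityˡ (f n)))
                             , (λ f → pointwise λ n → ≡.trans (cong (ℤ._+_ (f n)) (coeff-C0 n)) (ℤₚ.+-identityʳ (f n)))
                  }
                ; inverse = (λ f → pointwise λ n → ≡.trans (ℤₚ.+-inverseˡ (f n)) (≡.sym (coeff-C0 n)))
                          , (λ f → pointwise λ n → ≡.trans (ℤₚ.+-inverseʳ (f n)) (≡.sym (coeff-C0 n)))
                ; ⁻¹-cong = λ p → mk λ i≤N → cong ℤ.-_ (at p i≤N)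
                }
              ; comm = λ f g → pointwise λ n → ℤₚ.+-comm (f n) (g n)
              }
            -- Coefficient i of a product involves only coefficients of index at most i, so
            -- truncation respects products.
            ; *-cong = λ p r → mk λ i≤N →
                conv-cong _ (λ j≤i → at p (≤-trans j≤i i≤N)) (λ j≤i → at r (≤-trans j≤i i≤N))
            ; *-assoc = λ f g h → pointwise (conv-assoc f g h)
            ; *-identity = (λ f → pointwise (⊗-identity f))
                         , (λ f → pointwise λ n → ≡.trans (conv-comm f (C ℤ.1ℤ) n) (⊗-identity f n))
            ; distrib = (λ f g h → pointwise λ n →
                            ≡.trans (conv-comm f (g ⊕ h) n)
                              (≡.trans (conv-distribʳ f g h n)
                                (cong₂ ℤ._+_ (conv-comm g f n) (conv-comm h f n))))
                      , (λ f g h → pointwise (conv-distribʳ f g h))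
            }
          ; *-comm = λ f g → pointwise (conv-comm f g)
          }
        where
        ⊗-identity : ∀ f n → (C ℤ.1ℤ ⊗ f) n ≡ f n
        ⊗-identity f n = ≡.trans (coeff-C⊗ ℤ.1ℤ f n) (ℤₚ.*-identityˡ (f n))

      C-+ : ∀ a b → C (a ℤ.+ b) ≈ C a ⊕ C b
      C-+ a b = pointwise λ { zero → refl ; (suc n) → refl }

      C-* : ∀ a b → C (a ℤ.* b) ≈ C a ⊗ C b
      C-* a b = pointwise λ
        { zero    → refl
        ; (suc n) → ≡.sym (≡.trans (coeff-C⊗ a (C b) (suc n)) (ℤₚ.*-zeroʳ a)) }

      C-‿ : ∀ a → C (ℤ.- a) ≈ ⊝ C a
      C-‿ a = pointwise λ { zero → refl ; (suc n) → refl }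

    commutativeRing : CommutativeRing 0ℓ 0ℓ
    commutativeRing = record { isCommutativeRing = isCommutativeRing }

    open CommutativeRing commutativeRing public
      using (setoid; +-cong; *-cong; +-congˡ; +-congʳ; *-congˡ; *-congʳ; -‿cong; zeroˡ; zeroʳ)
      renaming (refl to ≈-refl; sym to ≈-sym; trans to ≈-trans; reflexive to ≈-reflexive;
                +-identityˡ to ⊕-identityˡ; +-identityʳ to ⊕-identityʳ;
                *-identityˡ to ⊗-identityˡ; *-identityʳ to ⊗-identityʳ)
    open import Relation.Binary.Reasoning.Setoid setoid public

    -- Integers serve as the solver's coefficients, embedded as constant series: their equality is
    -- decidable, that of series is not, and numerals such as 2 can then be combined and cancelled.
    C-morphism : ℤ.+-*-rawRing -Raw-AlmostCommutative⟶ fromCommutativeRing commutativeRing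
    C-morphism = record
      { ⟦_⟧    = C
      ; +-homo = C-+
      ; *-homo = C-*
      ; -‿homo = C-‿
      ; 0-homo = ≈-refl
      ; 1-homo = ≈-refl
      }

    C-weaklyDec : ∀ a b → Maybe (C a ≈ C b)
    C-weaklyDec a b = Maybe.map (λ eq → ≈-reflexive (cong C eq)) (dec⇒maybe (a ℤₚ.≟ b))

    open import Algebra.Solver.Ring ℤ.+-*-rawRing (fromCommutativeRing commutativeRing)
      C-morphism C-weaklyDec public
      using (Polynomial; solve; _:=_; _:+_; _:*_; _:-_; :-_; con)

    :1 : ∀ {n} → Polynomial n
    :1 = con ℤ.1ℤ

  -- Finite sums and products, monomials and geometric series.

  𝟘 𝟙 : Series
  𝟘 = C ℤ.0ℤ
  𝟙 = C ℤ.1ℤ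

  ∑ : (ℕ → Series) → ℕ → Series
  ∑ f zero    = f 0
  ∑ f (suc n) = ∑ f n ⊕ f (suc n)

  ∏ : (ℕ → Series) → ℕ → Series
  ∏ f zero    = 𝟙
  ∏ f (suc n) = ∏ f n ⊗ f n

  -- 1 / (1 - qˢ) for s > 0: the coefficient of qⁿ is read off the partial sum 1 + qˢ + ⋯ + qˢⁿ.
  geo : ℕ → Series
  geo s n = ∑ (λ x → X (s * x)) n n

  module Lemmas (N : ℕ) where
    open Trunc N

    X-0 : X 0 ≈ 𝟙
    X-0 = pointwise X0≗1

    X-vanish : ∀ {a} → N < a → X a ≈ 𝟘
    X-vanish N<a = mk λ {i} i≤N → ≡.trans (coeff-X< (≤-<-trans i≤N N<a)) (≡.sym (coeff-C0 i))

    X-+ : ∀ a b → X (a + b) ≈ X a ⊗ X b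
    X-+ a b = pointwise go
      where
      go : ∀ n → X (a + b) n ≡ (X a ⊗ X b) n
      go n with ≤-<-connex a n
      ... | inj₂ n<a = ≡.trans (coeff-X< (<-≤-trans n<a (m≤m+n a b))) (≡.sym (coeff-X⊗-< a (X b) n<a))
      ... | inj₁ a≤n rewrite ≡.sym (m+[n∸m]≡n a≤n) =
        ≡.trans (≡.sym (coeff-X+ a b (n ∸ a))) (≡.sym (coeff-X⊗-≥ a (X b) (n ∸ a)))

    X-split : ∀ {e} a b → e ≡ a + b → X e ≈ X a ⊗ X b
    X-split a b refl = X-+ a b

    X-split₃ : ∀ {e} a b c → e ≡ a + b + c → X e ≈ X a ⊗ X b ⊗ X c
    X-split₃ a b c refl = ≈-trans (X-+ (a + b) c) (*-congʳ (X-+ a b))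

    X-cong : ∀ {a b} → a ≡ b → X a ≈ X b
    X-cong = ≈-reflexive ∘ cong X

    ⊗X-vanish : ∀ f {a} → N < a → f ⊗ X a ≈ 𝟘
    ⊗X-vanish f N<a = ≈-trans (*-congˡ (X-vanish N<a)) (zeroʳ f)

    ∑-cong : ∀ {f g} → (∀ i → f i ≈ g i) → ∀ n → ∑ f n ≈ ∑ g n
    ∑-cong p zero    = p 0
    ∑-cong p (suc n) = +-cong (∑-cong p n) (p (suc n))

    ∑-⊕ : ∀ f g n → ∑ (λ i → f i ⊕ g i) n ≈ ∑ f n ⊕ ∑ g n
    ∑-⊕ f g zero    = ≈-refl
    ∑-⊕ f g (suc n) = ≈-trans (+-congʳ (∑-⊕ f g n))
      (solve 4 (λ a b c d → a :+ b :+ (c :+ d) := a :+ c :+ (b :+ d)) ≈-refl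
         (∑ f n) (∑ g n) (f (suc n)) (g (suc n)))

    ∑-⊗ʳ : ∀ f g n → ∑ (λ i → f i ⊗ g) n ≈ ∑ f n ⊗ g
    ∑-⊗ʳ f g zero    = ≈-refl
    ∑-⊗ʳ f g (suc n) = ≈-trans (+-congʳ (∑-⊗ʳ f g n))
      (solve 3 (λ a b c → a :* c :+ b :* c := (a :+ b) :* c) ≈-refl (∑ f n) (f (suc n)) g)

    ∑-head : ∀ f n → ∑ f (suc n) ≈ f 0 ⊕ ∑ (f ∘ suc) n
    ∑-head f zero    = ≈-refl
    ∑-head f (suc n) = ≈-trans (+-congʳ (∑-head f n))
      (solve 3 (λ a b c → a :+ b :+ c := a :+ (b :+ c)) ≈-refl (f 0) (∑ (f ∘ suc) n) (f (suc (suc n))))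

    ∑-extend : ∀ f n → (∀ i → n < i → f i ≈ 𝟘) → ∀ m → ∑ f (m + n) ≈ ∑ f n
    ∑-extend f n f≈0 zero    = ≈-refl
    ∑-extend f n f≈0 (suc m) =
      ≈-trans (+-cong (∑-extend f n f≈0 m) (f≈0 (suc m + n) (s≤s (m≤n+m n m)))) (⊕-identityʳ _)

    ∑-truncate : ∀ f {n m} → (∀ i → n < i → f i ≈ 𝟘) → n ≤ m → ∑ f m ≈ ∑ f n
    ∑-truncate f {n} {m} f≈0 n≤m =
      ≈-trans (≈-reflexive (cong (∑ f) (≡.sym (m∸n+n≡m n≤m)))) (∑-extend f n f≈0 (m ∸ n))

    ∑-vanish : ∀ f n → (∀ i → i ≤ n → f i ≈ 𝟘) → ∑ f n ≈ 𝟘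
    ∑-vanish f zero    f≈0 = f≈0 0 z≤n
    ∑-vanish f (suc n) f≈0 =
      ≈-trans (+-cong (∑-vanish f n (λ i i≤n → f≈0 i (m≤n⇒m≤1+n i≤n))) (f≈0 (suc n) ≤-refl)) (⊕-identityʳ _)

    ∏-cong : ∀ {f g} → (∀ i → f i ≈ g i) → ∀ n → ∏ f n ≈ ∏ g n
    ∏-cong p zero    = ≈-refl
    ∏-cong p (suc n) = *-cong (∏-cong p n) (p n)

    ∏-⊗ : ∀ f g n → ∏ (λ i → f i ⊗ g i) n ≈ ∏ f n ⊗ ∏ g n
    ∏-⊗ f g zero    = ≈-sym (⊗-identityˡ 𝟙)
    ∏-⊗ f g (suc n) = ≈-trans (*-congʳ (∏-⊗ f g n))
      (solve 4 (λ a b c d → a :* b :* (c :* d) := a :* c :* (b :* d)) ≈-refl (∏ f n) (∏ g n) (f n) (g n))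

    ∏-𝟙 : ∀ n → ∏ (λ _ → 𝟙) n ≈ 𝟙
    ∏-𝟙 zero    = ≈-refl
    ∏-𝟙 (suc n) = ≈-trans (⊗-identityʳ _) (∏-𝟙 n)

    ∏-inverse : ∀ f g → (∀ i → f i ⊗ g i ≈ 𝟙) → ∀ n → ∏ f n ⊗ ∏ g n ≈ 𝟙
    ∏-inverse f g p n = ≈-trans (≈-sym (∏-⊗ f g n)) (≈-trans (∏-cong p n) (∏-𝟙 n))

    ∏-head : ∀ f n → ∏ f (suc n) ≈ f 0 ⊗ ∏ (f ∘ suc) n
    ∏-head f zero    = ≈-trans (⊗-identityˡ _) (≈-sym (⊗-identityʳ _))
    ∏-head f (suc n) = ≈-trans (*-congʳ (∏-head f n))
      (solve 3 (λ a b c → a :* b :* c := a :* (b :* c)) ≈-refl (f 0) (∏ (f ∘ suc) n) (f (suc n)))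

    ∏-extend : ∀ f n → (∀ i → n ≤ i → f i ≈ 𝟙) → ∀ m → ∏ f (m + n) ≈ ∏ f n
    ∏-extend f n f≈1 zero    = ≈-refl
    ∏-extend f n f≈1 (suc m) =
      ≈-trans (*-cong (∏-extend f n f≈1 m) (f≈1 (m + n) (m≤n+m n m))) (⊗-identityʳ _)

    ∏-truncate : ∀ f {n m} → (∀ i → n ≤ i → f i ≈ 𝟙) → n ≤ m → ∏ f m ≈ ∏ f n
    ∏-truncate f {n} {m} f≈1 n≤m =
      ≈-trans (≈-reflexive (cong (∏ f) (≡.sym (m∸n+n≡m n≤m)))) (∏-extend f n f≈1 (m ∸ n))

    unit-cancelˡ : ∀ {u v} → u ⊗ v ≈ 𝟙 → ∀ {f g} → u ⊗ f ≈ u ⊗ g → f ≈ g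
    unit-cancelˡ {u} {v} uv≈1 {f} {g} uf≈ug = begin
      f             ≈⟨ ⊗-identityˡ f ⟨
      𝟙 ⊗ f         ≈⟨ *-congʳ uv≈1 ⟨
      u ⊗ v ⊗ f     ≈⟨ rotate u v f ⟩
      v ⊗ (u ⊗ f)   ≈⟨ *-congˡ uf≈ug ⟩
      v ⊗ (u ⊗ g)   ≈⟨ rotate u v g ⟨
      u ⊗ v ⊗ g     ≈⟨ *-congʳ uv≈1 ⟩
      𝟙 ⊗ g         ≈⟨ ⊗-identityˡ g ⟩
      g             ∎
      where
      rotate : ∀ u v f → u ⊗ v ⊗ f ≈ v ⊗ (u ⊗ f)
      rotate = solve 3 (λ u v f → u :* v :* f := v :* (u :* f)) ≈-refl

    1⊖X≈1 : ∀ {a} → N < a → 𝟙 ⊖ X a ≈ 𝟙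
    1⊖X≈1 N<a = ≈-trans (+-congˡ (-‿cong (X-vanish N<a)))
      (solve 0 (:1 :- con ℤ.0ℤ := :1) ≈-refl)

  -- Coefficient i of `geo s` comes from the sum of length i, so each i ≤ N is handled at its own
  -- precision i, where the summands beyond i vanish because s > 0.
  geo-≈-∑ : ∀ N s .{{_ : NonZero s}} → let open Trunc N in geo s ≈ ∑ (λ x → X (s * x)) N
  geo-≈-∑ N s = Trunc.mk λ {i} i≤N →
    ≡.sym (Trunc.at (Lemmas.∑-truncate i (λ x → X (s * x))
      (λ x i<x → Lemmas.X-vanish i (<-≤-trans i<x (m≤n*m x s))) i≤N) ≤-refl)

  module Geometric (N : ℕ) where
    open Trunc N
    open Lemmas N

    geo-partial : ∀ s n → (𝟙 ⊖ X s) ⊗ ∑ (λ x → X (s * x)) n ≈ 𝟙 ⊖ X (s * suc n)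
    geo-partial s zero = begin
      (𝟙 ⊖ X s) ⊗ X (s * 0)    ≈⟨ *-congˡ (≈-trans (X-cong (*-zeroʳ s)) X-0) ⟩
      (𝟙 ⊖ X s) ⊗ 𝟙            ≈⟨ ⊗-identityʳ _ ⟩
      𝟙 ⊖ X s                  ≈⟨ +-congˡ (-‿cong (X-cong (*-identityʳ s))) ⟨
      𝟙 ⊖ X (s * 1)            ∎
    geo-partial s (suc n) = begin
      (𝟙 ⊖ X s) ⊗ (∑ (λ x → X (s * x)) n ⊕ y)
        ≈⟨ solve 3 (λ a b c → (:1 :- a) :* (b :+ c) := (:1 :- a) :* b :+ (c :- a :* c)) ≈-refl (X s) _ y ⟩
      (𝟙 ⊖ X s) ⊗ ∑ (λ x → X (s * x)) n ⊕ (y ⊖ X s ⊗ y)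
        ≈⟨ +-cong (geo-partial s n) (+-congˡ (-‿cong (≈-sym (X-split s (s * suc n) (*-suc s (suc n)))))) ⟩
      𝟙 ⊖ y ⊕ (y ⊖ X (s * suc (suc n)))
        ≈⟨ solve 2 (λ y z → :1 :- y :+ (y :- z) := :1 :- z) ≈-refl y _ ⟩
      𝟙 ⊖ X (s * suc (suc n)) ∎
      where
      y : Series
      y = X (s * suc n)

    geo-inverse : ∀ s .{{_ : NonZero s}} → (𝟙 ⊖ X s) ⊗ geo s ≈ 𝟙
    geo-inverse s = begin
      (𝟙 ⊖ X s) ⊗ geo s                    ≈⟨ *-congˡ (geo-≈-∑ N s) ⟩
      (𝟙 ⊖ X s) ⊗ ∑ (λ x → X (s * x)) N    ≈⟨ geo-partial s N ⟩
      𝟙 ⊖ X (s * suc N)                    ≈⟨ 1⊖X≈1 (m≤n*m (suc N) s) ⟩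
      𝟙                                    ∎

    geo-vanish : ∀ s .{{_ : NonZero s}} → N < s → geo s ≈ 𝟙
    geo-vanish s N<s = unit-cancelˡ (geo-inverse s) (≈-trans (geo-inverse s)
      (≈-sym (≈-trans (⊗-identityʳ _) (1⊖X≈1 N<s))))

  -- The pentagonal number theorem in q², in finite form.

  ε : ℕ → Series
  ε zero    = 𝟙
  ε (suc s) = ⊝ ε s

  evenFactor oddFactor geoEven geoOdd : ℕ → Series
  evenFactor i = 𝟙 ⊖ X (2 * suc i)
  oddFactor  i = 𝟙 ⊖ X (suc (2 * i))
  geoEven    i = geo (2 * suc i)
  geoOdd     i = geo (suc (2 * i))

  -- The two exponents are j(3j-1) at j = n+1 and at j = -(n+1).
  pentSum : ℕ → Series
  pentSum zero    = 𝟙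
  pentSum (suc n) = pentSum n ⊕ ε (suc n) ⊗ (X (suc n * (3 * n + 2)) ⊕ X (suc n * (3 * n + 4)))

  -- Shanks: Σ_{s≤n} (-1)ˢ (Dₙ/Dₛ) q^(2sn + s(s+1)) = Σ_{|j|≤n} (-1)ʲ q^(j(3j-1)) with Dₙ = ∏_{i≤n} (1 - q²ⁱ).
  -- All terms with s > 0 vanish modulo q^(2n+1).
  module Pentagonal (N : ℕ) where
    open Trunc N
    open Lemmas N
    open Geometric N

    -- Dₙ/Dₛ is written with inverses instead of a product over s < i ≤ n, so that raising n or s
    -- multiplies by a single factor.
    D/D : ℕ → ℕ → Series
    D/D n s = ∏ evenFactor n ⊗ ∏ geoEven s

    -- `carry n s` is the telescoping certificate: what the partial sum up to s loses when n becomes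
    -- `suc n`.
    term carry : ℕ → ℕ → Series
    term  n s = ε s ⊗ D/D n s ⊗ X (2 * s * n + s * suc s)
    carry n s = ε s ⊗ D/D n s ⊗ X (2 * suc s * suc n + s * suc s)

    D/D-diag : ∀ n → D/D n n ≈ 𝟙
    D/D-diag = ∏-inverse evenFactor geoEven (λ i → geo-inverse (2 * suc i))

    D/D-pred : ∀ n s → D/D n s ≈ D/D n (suc s) ⊗ (𝟙 ⊖ X (2 * suc s))
    D/D-pred n s = begin
      d ⊗ j                    ≈⟨ ⊗-identityʳ _ ⟨
      d ⊗ j ⊗ 𝟙                ≈⟨ *-congˡ (geo-inverse (2 * suc s)) ⟨
      d ⊗ j ⊗ (u ⊗ geo (2 * suc s))      ≈⟨ solve 4 (λ d j u g → d :* j :* (u :* g) := d :* (j :* g) :* u) ≈-refl d j u _ ⟩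
      d ⊗ (j ⊗ geo (2 * suc s)) ⊗ u      ∎
      where
      d j u : Series
      d = ∏ evenFactor n
      j = ∏ geoEven s
      u = 𝟙 ⊖ X (2 * suc s)

    D/D-suc : ∀ n s → D/D (suc n) s ≈ D/D n s ⊗ (𝟙 ⊖ X (2 * suc n))
    D/D-suc n s = solve 3 (λ d u j → d :* u :* j := d :* j :* u) ≈-refl (∏ evenFactor n) _ (∏ geoEven s)

    -- Rests on y(1 - Q) = 1 - (1 - y) - yQ with y = q^(2(s+1)) and Q = q^(2(n+1)). The factor 1 - y
    -- turns Dₙ/Dₛ₊₁ into Dₙ/Dₛ, which gives `carry n s`; the factor yQ raises the exponent to that
    -- of `carry n (suc s)`.
    step : ∀ n s → term (suc n) (suc s) ≈ term n (suc s) ⊕ carry n s ⊖ carry n (suc s)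
    step n s = begin
      ⊝ e ⊗ D/D (suc n) (suc s) ⊗ X (2 * suc s * suc n + suc s * suc (suc s))
        ≈⟨ *-cong (*-congˡ (D/D-suc n (suc s))) (X-split (2 * suc s) E (e₁ n s)) ⟩
      ⊝ e ⊗ (a ⊗ (𝟙 ⊖ Q)) ⊗ (y ⊗ b)
        ≈⟨ solve 5 (λ e a y Q b →
             (:- e) :* (a :* (:1 :- Q)) :* (y :* b)
               := (:- e) :* a :* b :+ e :* (a :* (:1 :- y)) :* b :- (:- e) :* a :* (y :* Q :* b))
             ≈-refl e a y Q b ⟩
      ⊝ e ⊗ a ⊗ b ⊕ e ⊗ (a ⊗ (𝟙 ⊖ y)) ⊗ b ⊖ ⊝ e ⊗ a ⊗ (y ⊗ Q ⊗ b)
        ≈⟨ +-cong (+-congˡ (*-cong (*-congˡ (D/D-pred n s)) (X-cong (e₂ n s))))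
                  (-‿cong (*-congˡ (X-split₃ (2 * suc s) (2 * suc n) E (e₃ n s)))) ⟨
      term n (suc s) ⊕ carry n s ⊖ carry n (suc s) ∎
      where
      E : ℕ
      E = 2 * suc s * n + suc s * suc (suc s)
      e a y Q b : Series
      e = ε s
      a = D/D n (suc s)
      y = X (2 * suc s)
      Q = X (2 * suc n)
      b = X E
      e₁ : ∀ n s → 2 * suc s * suc n + suc s * suc (suc s) ≡ 2 * suc s + (2 * suc s * n + suc s * suc (suc s))
      e₁ = solve-∀
      e₂ : ∀ n s → 2 * suc s * suc n + s * suc s ≡ 2 * suc s * n + suc s * suc (suc s)
      e₂ = solve-∀
      e₃ : ∀ n s → 2 * suc (suc s) * suc n + suc s * suc (suc s)
                   ≡ 2 * suc s + 2 * suc n + (2 * suc s * n + suc s * suc (suc s))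
      e₃ = solve-∀

    step₀ : ∀ n → term (suc n) 0 ≈ term n 0 ⊖ carry n 0
    step₀ n = begin
      𝟙 ⊗ D/D (suc n) 0 ⊗ X 0                 ≈⟨ *-cong (*-congˡ (D/D-suc n 0)) X-0 ⟩
      𝟙 ⊗ (a ⊗ (𝟙 ⊖ Q)) ⊗ 𝟙
        ≈⟨ solve 2 (λ a Q → :1 :* (a :* (:1 :- Q)) :* :1 := :1 :* a :* :1 :- :1 :* a :* Q) ≈-refl a Q ⟩
      𝟙 ⊗ a ⊗ 𝟙 ⊖ 𝟙 ⊗ a ⊗ Q
        ≈⟨ +-cong (*-congˡ X-0) (-‿cong (*-congˡ (X-cong (+-identityʳ (2 * suc n))))) ⟨
      term n 0 ⊖ carry n 0 ∎
      where
      a Q : Series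
      a = D/D n 0
      Q = X (2 * suc n)

    telescope : ∀ n m → ∑ (term (suc n)) m ≈ ∑ (term n) m ⊖ carry n m
    telescope n zero    = step₀ n
    telescope n (suc m) = ≈-trans (+-cong (telescope n m) (step n m))
      (solve 4 (λ a b c d → a :- b :+ (c :+ b :- d) := a :+ c :- d) ≈-refl
         (∑ (term n) m) (carry n m) (term n (suc m)) (carry n (suc m)))

    -- When n grows by one, both new pentagonal terms arise at the upper end: -`carry n n` supplies
    -- j = n+1 and the additional summand s = n+1 supplies j = -(n+1).
    ∑-term-pentSum : ∀ n → ∑ (term n) n ≈ pentSum n
    ∑-term-pentSum zero = begin
      𝟙 ⊗ (𝟙 ⊗ 𝟙) ⊗ X 0 ≈⟨ *-congˡ X-0 ⟩
      𝟙 ⊗ (𝟙 ⊗ 𝟙) ⊗ 𝟙   ≈⟨ solve 0 (:1 :* (:1 :* :1) :* :1 := :1) ≈-refl ⟩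
      𝟙                 ∎
    ∑-term-pentSum (suc n) = begin
      ∑ (term (suc n)) n ⊕ term (suc n) (suc n)
        ≈⟨ +-congʳ (telescope n n) ⟩
      ∑ (term n) n ⊖ carry n n ⊕ term (suc n) (suc n)
        ≈⟨ +-cong (+-cong (∑-term-pentSum n) (-‿cong (*-cong (*-congˡ (D/D-diag n)) (X-cong (e₁ n)))))
                  (*-cong (*-congˡ (D/D-diag (suc n))) (X-cong (e₂ n))) ⟩
      pentSum n ⊖ ε n ⊗ 𝟙 ⊗ x₁ ⊕ ⊝ ε n ⊗ 𝟙 ⊗ x₂
        ≈⟨ solve 4 (λ p e x₁ x₂ → p :- e :* :1 :* x₁ :+ (:- e) :* :1 :* x₂ := p :+ (:- e) :* (x₁ :+ x₂))
             ≈-refl (pentSum n) (ε n) x₁ x₂ ⟩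
      pentSum (suc n) ∎
      where
      x₁ x₂ : Series
      x₁ = X (suc n * (3 * n + 2))
      x₂ = X (suc n * (3 * n + 4))
      e₁ : ∀ n → 2 * suc n * suc n + n * suc n ≡ suc n * (3 * n + 2)
      e₁ = solve-∀
      e₂ : ∀ n → 2 * suc n * suc n + suc n * suc (suc n) ≡ suc n * (3 * n + 4)
      e₂ = solve-∀

    pentagonal : ∀ {n} → N ≤ n → pentSum n ≈ ∏ evenFactor n
    pentagonal {n} N≤n = begin
      pentSum n                          ≈⟨ ∑-term-pentSum n ⟨
      ∑ (term n) n                       ≈⟨ ∑-truncate (term n) {m = n} vanish z≤n ⟩
      𝟙 ⊗ (∏ evenFactor n ⊗ 𝟙) ⊗ X 0     ≈⟨ *-congˡ X-0 ⟩
      𝟙 ⊗ (∏ evenFactor n ⊗ 𝟙) ⊗ 𝟙       ≈⟨ solve 1 (λ d → :1 :* (d :* :1) :* :1 := d) ≈-refl _ ⟩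
      ∏ evenFactor n                     ∎
      where
      vanish : ∀ s → 0 < s → term n s ≈ 𝟘
      vanish (suc s) _ = ⊗X-vanish _
        (≤-<-trans (≤-trans N≤n (m≤n*m n (2 * suc s))) (m<m+n _ (s≤s z≤n)))

  -- Gauss's product for the series of triangular exponents.

  triangular : ℕ → ℕ
  triangular zero    = 0
  triangular (suc m) = suc m + triangular m

  triangular-even : ∀ n → triangular (n + n) ≡ n * suc (2 * n)
  triangular-even zero    = refl
  triangular-even (suc n) rewrite +-suc n n | triangular-even n = lemma n
    where
    lemma : ∀ n → suc (suc (n + n)) + (suc (n + n) + n * suc (2 * n)) ≡ suc n * suc (2 * suc n)
    lemma = solve-∀

  m≤triangular : ∀ m → m ≤ triangular m
  m≤triangular zero    = z≤n
  m≤triangular (suc m) = m≤m+n (suc m) (triangular m)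

  theta₂ : ℕ → Series
  theta₂ = ∑ (λ m → X (triangular m))

  -- Shanks: Σ_{s≤n} (Pₙ/Pₛ) q^(s(2n+1)) = Σ_{m≤2n} q^(m(m+1)/2) with Pₙ = ∏_{i≤n} (1 - q²ⁱ)/(1 - q²ⁱ⁻¹).
  module Triangular (N : ℕ) where
    open Trunc N
    open Lemmas N
    open Geometric N

    P P⁻¹ : ℕ → Series
    P   = ∏ (λ i → evenFactor i ⊗ geoOdd i)
    P⁻¹ = ∏ (λ i → geoEven i ⊗ oddFactor i)

    P/P : ℕ → ℕ → Series
    P/P n s = P n ⊗ P⁻¹ s

    -- Here `carry n s` is what the partial sum up to s gains when n becomes `suc n`; its last
    -- factor is the denominator 1 - q^(2n+1) that Pₙ₊₁ introduces.
    term carry : ℕ → ℕ → Series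
    term  n s = P/P n s ⊗ X (s * suc (2 * n))
    carry n s = (𝟙 ⊖ X (suc (2 * s))) ⊗ P/P n s ⊗ X (suc s * suc (2 * n)) ⊗ geo (suc (2 * n))

    P/P-diag : ∀ n → P/P n n ≈ 𝟙
    P/P-diag = ∏-inverse _ _ λ i → begin
      (evenFactor i ⊗ geoOdd i) ⊗ (geoEven i ⊗ oddFactor i)
        ≈⟨ solve 4 (λ a b c d → (a :* b) :* (c :* d) := (a :* c) :* (d :* b)) ≈-refl
             (evenFactor i) (geoOdd i) (geoEven i) (oddFactor i) ⟩
      (evenFactor i ⊗ geoEven i) ⊗ (oddFactor i ⊗ geoOdd i)
        ≈⟨ *-cong (geo-inverse (2 * suc i)) (geo-inverse (suc (2 * i))) ⟩
      𝟙 ⊗ 𝟙 ≈⟨ ⊗-identityˡ 𝟙 ⟩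
      𝟙 ∎

    P/P-pred : ∀ n s → oddFactor s ⊗ P/P n s ≈ P/P n (suc s) ⊗ evenFactor s
    P/P-pred n s = begin
      z ⊗ (P n ⊗ k)                ≈⟨ ⊗-identityʳ _ ⟨
      z ⊗ (P n ⊗ k) ⊗ 𝟙            ≈⟨ *-congˡ (geo-inverse (2 * suc s)) ⟨
      z ⊗ (P n ⊗ k) ⊗ (u ⊗ h)      ≈⟨ solve 5 (λ p k z u h → z :* (p :* k) :* (u :* h) := p :* (k :* (h :* z)) :* u)
                                        ≈-refl (P n) k z u h ⟩
      P n ⊗ (k ⊗ (h ⊗ z)) ⊗ u      ∎
      where
      k z u h : Series
      k = P⁻¹ s
      z = oddFactor s
      u = evenFactor s
      h = geoEven s

    P/P-suc : ∀ n s → P/P (suc n) s ≈ P/P n s ⊗ (evenFactor n ⊗ geoOdd n)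
    P/P-suc n s = solve 3 (λ d u j → d :* u :* j := d :* j :* u) ≈-refl (P n) _ (P⁻¹ s)

    -- The exponents give Q₂y = Q₁w, so y(1 - Q₂) = y - Q₁w = (1 - Q₁) + (1 - w)Q₁ - (1 - y). In
    -- this order the three pieces are the old term, after 1 - Q₁ cancels against `g`, and the two
    -- carries.
    step : ∀ n s → term (suc n) (suc s) ≈ term n (suc s) ⊕ carry n (suc s) ⊖ carry n s
    step n s = begin
      P/P (suc n) (suc s) ⊗ X (suc s * suc (2 * suc n))
        ≈⟨ *-cong (P/P-suc n (suc s)) (X-split (2 * suc s) E (e₁ n s)) ⟩
      a ⊗ ((𝟙 ⊖ Q₂) ⊗ g) ⊗ (y ⊗ b)
        ≈⟨ solve 5 (λ a Q₂ g y b →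
             a :* ((:1 :- Q₂) :* g) :* (y :* b) := a :* b :* g :* y :- a :* b :* g :* (Q₂ :* y))
             ≈-refl a Q₂ g y b ⟩
      a ⊗ b ⊗ g ⊗ y ⊖ a ⊗ b ⊗ g ⊗ (Q₂ ⊗ y)
        ≈⟨ +-congˡ (-‿cong (*-congˡ Q₂y≈Q₁w)) ⟩
      a ⊗ b ⊗ g ⊗ y ⊖ a ⊗ b ⊗ g ⊗ (Q₁ ⊗ w)
        ≈⟨ solve 6 (λ a Q₁ g y b w →
             a :* b :* g :* y :- a :* b :* g :* (Q₁ :* w)
             := a :* b :* ((:1 :- Q₁) :* g) :+ (:1 :- w) :* a :* (Q₁ :* b) :* g :- a :* (:1 :- y) :* b :* g)
             ≈-refl a Q₁ g y b w ⟩
      a ⊗ b ⊗ ((𝟙 ⊖ Q₁) ⊗ g) ⊕ (𝟙 ⊖ w) ⊗ a ⊗ (Q₁ ⊗ b) ⊗ g ⊖ a ⊗ (𝟙 ⊖ y) ⊗ b ⊗ g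
        ≈⟨ +-cong (+-cong (≈-trans (*-congˡ (geo-inverse (suc (2 * n)))) (⊗-identityʳ _))
                          (*-congʳ (*-congˡ (≈-sym (X-split (suc (2 * n)) E refl)))))
                  (-‿cong (*-congʳ (*-congʳ (≈-sym (P/P-pred n s))))) ⟩
      term n (suc s) ⊕ carry n (suc s) ⊖ carry n s ∎
      where
      E : ℕ
      E = suc s * suc (2 * n)
      a Q₁ Q₂ g y b w : Series
      a  = P/P n (suc s)
      Q₁ = X (suc (2 * n))
      Q₂ = X (2 * suc n)
      g  = geoOdd n
      y  = X (2 * suc s)
      b  = X E
      w  = X (suc (2 * suc s))
      e₁ : ∀ n s → suc s * suc (2 * suc n) ≡ 2 * suc s + suc s * suc (2 * n)
      e₁ = solve-∀
      e₂ : ∀ n s → 2 * suc n + 2 * suc s ≡ suc (2 * n) + suc (2 * suc s)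
      e₂ = solve-∀
      Q₂y≈Q₁w : Q₂ ⊗ y ≈ Q₁ ⊗ w
      Q₂y≈Q₁w = ≈-trans (≈-sym (X-+ (2 * suc n) (2 * suc s))) (X-split _ _ (e₂ n s))

    step₀ : ∀ n → term (suc n) 0 ≈ term n 0 ⊕ carry n 0
    step₀ n = begin
      P/P (suc n) 0 ⊗ X 0                ≈⟨ *-cong (P/P-suc n 0) X-0 ⟩
      a ⊗ ((𝟙 ⊖ X (2 * suc n)) ⊗ g) ⊗ 𝟙  ≈⟨ *-congʳ (*-congˡ (*-congʳ (+-congˡ (-‿cong
                                              (X-split 1 (suc (2 * n)) (e₁ n)))))) ⟩
      a ⊗ ((𝟙 ⊖ x ⊗ Q₁) ⊗ g) ⊗ 𝟙
        ≈⟨ solve 4 (λ a x Q₁ g → a :* ((:1 :- x :* Q₁) :* g) :* :1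
                                 := a :* ((:1 :- Q₁) :* g) :+ (:1 :- x) :* a :* Q₁ :* g) ≈-refl a x Q₁ g ⟩
      a ⊗ ((𝟙 ⊖ Q₁) ⊗ g) ⊕ (𝟙 ⊖ x) ⊗ a ⊗ Q₁ ⊗ g
        ≈⟨ +-cong (*-congˡ (≈-trans (geo-inverse (suc (2 * n))) (≈-sym X-0)))
                  (*-congʳ (*-congˡ (X-cong (≡.sym (*-identityˡ _))))) ⟩
      term n 0 ⊕ carry n 0 ∎
      where
      a x Q₁ g : Series
      a  = P/P n 0
      x  = X 1
      Q₁ = X (suc (2 * n))
      g  = geoOdd n
      e₁ : ∀ n → 2 * suc n ≡ 1 + suc (2 * n)
      e₁ = solve-∀

    telescope : ∀ n m → ∑ (term (suc n)) m ≈ ∑ (term n) m ⊕ carry n m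
    telescope n zero    = step₀ n
    telescope n (suc m) = ≈-trans (+-cong (telescope n m) (step n m))
      (solve 4 (λ a b c d → a :+ b :+ (c :+ d :- b) := a :+ c :+ d) ≈-refl
         (∑ (term n) m) (carry n m) (term n (suc m)) (carry n (suc m)))

    -- Each step adds two triangular exponents: `carry n n` collapses to the one of index 2n+1, and
    -- the new summand s = n+1 is the one of index 2n+2.
    ∑-term-theta₂ : ∀ n → ∑ (term n) n ≈ theta₂ (n + n)
    ∑-term-theta₂ zero    = ≈-trans (*-congʳ (⊗-identityˡ 𝟙)) (⊗-identityˡ (X 0))
    ∑-term-theta₂ (suc n) = begin
      ∑ (term (suc n)) n ⊕ term (suc n) (suc n)
        ≈⟨ +-cong (telescope n n) (≈-trans (*-congʳ (P/P-diag (suc n))) (⊗-identityˡ _)) ⟩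
      ∑ (term n) n ⊕ carry n n ⊕ X (suc n * suc (2 * suc n))
        ≈⟨ +-cong (+-cong (∑-term-theta₂ n) carry-diag) (X-cong (≡.sym (triangular-even (suc n)))) ⟩
      theta₂ (n + n) ⊕ X (triangular (suc (n + n))) ⊕ X (triangular (suc n + suc n))
        ≡⟨ cong (λ m → theta₂ (n + n) ⊕ X (triangular (suc (n + n))) ⊕ X (triangular m)) (cong suc (+-suc n n)) ⟩
      theta₂ (suc (suc (n + n)))
        ≡⟨ cong (λ m → theta₂ (suc m)) (+-suc n n) ⟨
      theta₂ (suc n + suc n) ∎
      where
      e₁ : ∀ n → suc n * suc (2 * n) ≡ suc (n + n) + n * suc (2 * n)
      e₁ = solve-∀
      carry-diag : carry n n ≈ X (triangular (suc (n + n)))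
      carry-diag = begin
        u ⊗ P/P n n ⊗ x ⊗ g   ≈⟨ *-congʳ (*-congʳ (*-congˡ (P/P-diag n))) ⟩
        u ⊗ 𝟙 ⊗ x ⊗ g         ≈⟨ solve 3 (λ u x g → u :* :1 :* x :* g := u :* g :* x) ≈-refl u x g ⟩
        u ⊗ g ⊗ x             ≈⟨ *-congʳ (geo-inverse (suc (2 * n))) ⟩
        𝟙 ⊗ x                 ≈⟨ ⊗-identityˡ x ⟩
        x                     ≈⟨ X-cong (≡.trans (e₁ n) (cong (suc (n + n) +_) (≡.sym (triangular-even n)))) ⟩
        X (triangular (suc (n + n))) ∎
        where
        u x g : Series
        u = oddFactor n
        x = X (suc n * suc (2 * n))
        g = geoOdd n

    -- At n = N the summands with s > 0 have exponent s(2N+1) > N, so only s = 0 survives. On the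
    -- theta side, triangular numbers of index above N exceed N, so the range 2N may be cut to N.
    theta₂-P : theta₂ N ≈ P N
    theta₂-P = begin
      theta₂ N              ≈⟨ ∑-truncate (X ∘ triangular) (λ m N<m → X-vanish (<-≤-trans N<m (m≤triangular m)))
                                 (m≤m+n N N) ⟨
      theta₂ (N + N)        ≈⟨ ∑-term-theta₂ N ⟨
      ∑ (term N) N          ≈⟨ ∑-truncate (term N) {m = N} vanish z≤n ⟩
      P N ⊗ 𝟙 ⊗ X 0         ≈⟨ *-congˡ X-0 ⟩
      P N ⊗ 𝟙 ⊗ 𝟙           ≈⟨ solve 1 (λ p → p :* :1 :* :1 := p) ≈-refl (P N) ⟩
      P N                   ∎
      where
      vanish : ∀ s → 0 < s → term N s ≈ 𝟘
      vanish (suc s) _ = ⊗X-vanish _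
        (≤-trans (s≤s (m≤m+n N (N + 0))) (m≤n*m (suc (2 * N)) (suc s)))

    -- In q-Pochhammer notation: (-q;q)ₙ, (q;q)ₙ, (q;q²)ₙ and (q²;q²)ₙ.
    E A O D : ℕ → Series
    E = ∏ (λ i → 𝟙 ⊕ X (suc i))
    A = ∏ (λ i → 𝟙 ⊖ X (suc i))
    O = ∏ oddFactor
    D = ∏ evenFactor

    E⊗A≈D : ∀ n → E n ⊗ A n ≈ D n
    E⊗A≈D n = ≈-trans (≈-sym (∏-⊗ _ _ n)) (∏-cong factor n)
      where
      double : ∀ i → 2 * suc i ≡ suc i + suc i
      double = solve-∀
      factor : ∀ i → (𝟙 ⊕ X (suc i)) ⊗ (𝟙 ⊖ X (suc i)) ≈ evenFactor i
      factor i = ≈-trans (solve 1 (λ x → (:1 :+ x) :* (:1 :- x) := :1 :- x :* x) ≈-refl (X (suc i)))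
        (+-congˡ (-‿cong (≈-sym (X-split (suc i) (suc i) (double i)))))

    A-double : ∀ n → A (n + n) ≈ O n ⊗ D n
    A-double zero    = ≈-sym (⊗-identityˡ 𝟙)
    A-double (suc n) = begin
      A (suc n + suc n)                          ≡⟨ cong (A ∘ suc) (+-suc n n) ⟩
      A (n + n) ⊗ (𝟙 ⊖ X (suc (n + n))) ⊗ (𝟙 ⊖ X (suc (suc (n + n))))
        ≈⟨ *-cong (*-cong (A-double n) (+-congˡ (-‿cong (X-cong (e₁ n))))) (+-congˡ (-‿cong (X-cong (e₂ n)))) ⟩
      O n ⊗ D n ⊗ oddFactor n ⊗ evenFactor n
        ≈⟨ solve 4 (λ o d a b → o :* d :* a :* b := (o :* a) :* (d :* b)) ≈-refl
             (O n) (D n) (oddFactor n) (evenFactor n) ⟩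
      O (suc n) ⊗ D (suc n) ∎
      where
      e₁ : ∀ n → suc (n + n) ≡ suc (2 * n)
      e₁ = solve-∀
      e₂ : ∀ n → suc (suc (n + n)) ≡ 2 * suc n
      e₂ = solve-∀

    A-inverse : ∀ n → A n ⊗ ∏ (geo ∘ suc) n ≈ 𝟙
    A-inverse = ∏-inverse _ _ (λ i → geo-inverse (suc i))

    -- Euler's (-q)∞ (q;q²)∞ = 1, obtained after multiplication by (q)∞.
    E⊗O≈1 : E N ⊗ O N ≈ 𝟙
    E⊗O≈1 = unit-cancelˡ (A-inverse N) (begin
      A N ⊗ (E N ⊗ O N)  ≈⟨ solve 3 (λ a e o → a :* (e :* o) := o :* (e :* a)) ≈-refl (A N) (E N) (O N) ⟩
      O N ⊗ (E N ⊗ A N)  ≈⟨ *-congˡ (E⊗A≈D N) ⟩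
      O N ⊗ D N          ≈⟨ A-double N ⟨
      A (N + N)          ≈⟨ ∏-truncate _ (λ i N≤i → 1⊖X≈1 (s≤s N≤i)) (m≤m+n N N) ⟩
      A N                ≈⟨ ⊗-identityʳ _ ⟨
      A N ⊗ 𝟙            ∎)

    -- Euler's identity trades the denominator (q;q²) of `P N` for (-q;q), the numerator of G. The
    -- partition product 1/(q;q) will supply the denominator of G.
    theta₂-product : theta₂ N ≈ D N ⊗ E N
    theta₂-product = begin
      theta₂ N                          ≈⟨ theta₂-P ⟩
      P N                               ≈⟨ ∏-⊗ evenFactor geoOdd N ⟩
      D N ⊗ ∏ geoOdd N                  ≈⟨ *-congˡ (⊗-identityˡ _) ⟨
      D N ⊗ (𝟙 ⊗ ∏ geoOdd N)            ≈⟨ *-congˡ (*-congʳ E⊗O≈1) ⟨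
      D N ⊗ (E N ⊗ O N ⊗ ∏ geoOdd N)    ≈⟨ solve 4 (λ d e o g → d :* (e :* o :* g) := d :* e :* (o :* g)) ≈-refl
                                             (D N) (E N) (O N) _ ⟩
      D N ⊗ E N ⊗ (O N ⊗ ∏ geoOdd N)    ≈⟨ *-congˡ (∏-inverse oddFactor geoOdd (λ i → geo-inverse (suc (2 * i))) N) ⟩
      D N ⊗ E N ⊗ 𝟙                     ≈⟨ ⊗-identityʳ _ ⟩
      D N ⊗ E N                         ∎

  -- Weighted generating functions of multiplicity vectors.

  ≰ᵇ : ∀ {m n} → n < m → (m ≤ᵇ n) ≡ false
  ≰ᵇ {m} {n} n<m with m ≤ᵇ n in eq
  ... | false = refl
  ... | true  = contradiction (≤ᵇ⇒≤ m n (≡.subst T (≡.sym eq) _)) (<⇒≱ n<m)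

  ∑ₗ : ∀ {A : Set} → (A → Series) → List A → Series
  ∑ₗ f []       = 𝟘
  ∑ₗ f (x ∷ xs) = f x ⊕ ∑ₗ f xs

  opaque
    -- The smallest part size s is a parameter so that recursion on the vector is possible. With b =
    -- N and s > 0 the cap on multiplicities is invisible modulo q^(N+1).
    boxSeries : ∀ {l} → ℕ → (Vec ℕ l → ℕ) → ℕ → Series
    boxSeries {l} b v s = ∑ₗ (λ c → C (ℤ.+ v c) ⊗ X (wt s c)) (box l b)

  -- Two to the number of distinct parts. This weight replaces the flag vectors and turns
  -- overpartitions into weighted partitions.
  overlinings : ∀ {l} → Vec ℕ l → ℕ
  overlinings []          = 1
  overlinings (zero  ∷ c) = overlinings c
  overlinings (suc _ ∷ c) = 2 * overlinings c

  overlinings-if : ∀ {l} → ℕ → ℕ → Vec ℕ l → ℕ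
  overlinings-if k s c = if firstAboveCond k s c then overlinings c else 0

  overGeo : ℕ → Series
  overGeo s = (𝟙 ⊕ X s) ⊗ geo s

  ∏from : (ℕ → Series) → ℕ → ℕ → Series
  ∏from f s = ∏ (λ i → f (s + i))

  geoTail : ℕ → ℕ → ℕ → Series
  geoTail t s x = if ⌊ suc t ≤? x ⌋ then X (s * x) else 𝟘

  -- Σₘ q^(s + (s+1) + ⋯ + (s+m)) over m < l.
  mexTail : ℕ → ℕ → Series
  mexTail s zero    = 𝟘
  mexTail s (suc l) = X s ⊗ (𝟙 ⊕ mexTail (suc s) l)

  module Boxes (N : ℕ) where
    open Trunc N
    open Lemmas N
    open Geometric N

    module _ {A : Set} where
      ∑ₗ-++ : ∀ (f : A → Series) xs ys → ∑ₗ f (xs ++ ys) ≈ ∑ₗ f xs ⊕ ∑ₗ f ys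
      ∑ₗ-++ f []       ys = ≈-sym (⊕-identityˡ _)
      ∑ₗ-++ f (x ∷ xs) ys = ≈-trans (+-congˡ (∑ₗ-++ f xs ys))
        (solve 3 (λ a b c → a :+ (b :+ c) := a :+ b :+ c) ≈-refl (f x) (∑ₗ f xs) (∑ₗ f ys))

      ∑ₗ-cong : ∀ {f g : A → Series} → (∀ x → f x ≈ g x) → ∀ xs → ∑ₗ f xs ≈ ∑ₗ g xs
      ∑ₗ-cong p []       = ≈-refl
      ∑ₗ-cong p (x ∷ xs) = +-cong (p x) (∑ₗ-cong p xs)

      ∑ₗ-⊗ˡ : ∀ r (f : A → Series) xs → ∑ₗ (λ x → r ⊗ f x) xs ≈ r ⊗ ∑ₗ f xs
      ∑ₗ-⊗ˡ r f []       = ≈-sym (zeroʳ r)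
      ∑ₗ-⊗ˡ r f (x ∷ xs) = ≈-trans (+-congˡ (∑ₗ-⊗ˡ r f xs))
        (solve 3 (λ r a b → r :* a :+ r :* b := r :* (a :+ b)) ≈-refl r (f x) (∑ₗ f xs))

      ∑ₗ-map : ∀ {B : Set} (f : A → Series) (h : B → A) xs → ∑ₗ f (map h xs) ≈ ∑ₗ (f ∘ h) xs
      ∑ₗ-map f h []       = ≈-refl
      ∑ₗ-map f h (x ∷ xs) = +-congˡ (∑ₗ-map f h xs)

      ∑ₗ-concatMap : ∀ {B : Set} (f : A → Series) (h : B → List A) xs →
                     ∑ₗ f (concatMap h xs) ≈ ∑ₗ (λ x → ∑ₗ f (h x)) xs
      ∑ₗ-concatMap f h []       = ≈-refl
      ∑ₗ-concatMap f h (x ∷ xs) = ≈-trans (∑ₗ-++ f (h x) (concatMap h xs)) (+-congˡ (∑ₗ-concatMap f h xs))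

      ∑ₗ-applyUpTo : ∀ (f : A → Series) g n → ∑ₗ f (applyUpTo g (suc n)) ≈ ∑ (f ∘ g) n
      ∑ₗ-applyUpTo f g zero    = ⊕-identityʳ _
      ∑ₗ-applyUpTo f g (suc n) =
        ≈-trans (+-congˡ (∑ₗ-applyUpTo f (g ∘ suc) n)) (≈-sym (∑-head (f ∘ g) n))

    opaque
      unfolding boxSeries

      boxSeries-suc : ∀ {l} (v : Vec ℕ (suc l) → ℕ) s →
        boxSeries N v s ≈ ∑ (λ x → X (s * x) ⊗ boxSeries N (v ∘ (x ∷_)) (suc s)) N
      boxSeries-suc {l} v s = begin
        ∑ₗ f (concatMap (λ x → map (x ∷_) (box l N)) (upTo (suc N)))
          ≈⟨ ∑ₗ-concatMap f (λ x → map (x ∷_) (box l N)) (upTo (suc N)) ⟩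
        ∑ₗ (λ x → ∑ₗ f (map (x ∷_) (box l N))) (upTo (suc N))
          ≈⟨ ∑ₗ-applyUpTo _ id N ⟩
        ∑ (λ x → ∑ₗ f (map (x ∷_) (box l N))) N
          ≈⟨ ∑-cong (λ x → ≈-trans (∑ₗ-map f (x ∷_) (box l N))
               (≈-trans (∑ₗ-cong (split x) (box l N)) (∑ₗ-⊗ˡ (X (s * x)) _ (box l N)))) N ⟩
        ∑ (λ x → X (s * x) ⊗ boxSeries N (v ∘ (x ∷_)) (suc s)) N ∎
        where
        f : Vec ℕ (suc l) → Series
        f c = C (ℤ.+ v c) ⊗ X (wt s c)
        split : ∀ x c → f (x ∷ c) ≈ X (s * x) ⊗ (C (ℤ.+ v (x ∷ c)) ⊗ X (wt (suc s) c))
        split x c = ≈-trans (*-congˡ (X-+ (s * x) (wt (suc s) c)))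
          (solve 3 (λ a b c → a :* (b :* c) := b :* (a :* c)) ≈-refl _ (X (s * x)) (X (wt (suc s) c)))

      boxSeries-cong : ∀ {l} {v w : Vec ℕ l → ℕ} → (∀ c → v c ≡ w c) → ∀ s → boxSeries N v s ≈ boxSeries N w s
      boxSeries-cong {l} p s = ∑ₗ-cong (λ c → *-congʳ (≈-reflexive (cong (λ z → C (ℤ.+ z)) (p c)))) (box l N)

      boxSeries-* : ∀ {l} m (v : Vec ℕ l → ℕ) s → boxSeries N (λ c → m * v c) s ≈ C (ℤ.+ m) ⊗ boxSeries N v s
      boxSeries-* {l} m v s = ≈-trans (∑ₗ-cong scale (box l N)) (∑ₗ-⊗ˡ (C (ℤ.+ m)) _ (box l N))
        where
        scale : ∀ c → C (ℤ.+ (m * v c)) ⊗ X (wt s c) ≈ C (ℤ.+ m) ⊗ (C (ℤ.+ v c) ⊗ X (wt s c))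
        scale c = ≈-trans
          (*-congʳ (≈-trans (≈-reflexive (cong C (ℤₚ.pos-* m (v c)))) (C-* (ℤ.+ m) (ℤ.+ v c))))
          (solve 3 (λ a b c → a :* b :* c := a :* (b :* c)) ≈-refl (C (ℤ.+ m)) (C (ℤ.+ v c)) (X (wt s c)))

      boxSeries-[] : ∀ v s → boxSeries N v s ≈ C (ℤ.+ v [])
      boxSeries-[] v s = begin
        C (ℤ.+ v []) ⊗ X 0 ⊕ 𝟘   ≈⟨ +-congʳ (*-congˡ X-0) ⟩
        C (ℤ.+ v []) ⊗ 𝟙 ⊕ 𝟘     ≈⟨ solve 1 (λ a → a :* :1 :+ con ℤ.0ℤ := a) ≈-refl _ ⟩
        C (ℤ.+ v [])             ∎

    boxSeries-0 : ∀ {l} {v : Vec ℕ l → ℕ} → (∀ c → v c ≡ 0) → ∀ s → boxSeries N v s ≈ 𝟘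
    boxSeries-0 p s = ≈-trans (boxSeries-cong {w = λ c → 0 * 0} p s)
      (≈-trans (boxSeries-* 0 (λ _ → 0) s) (zeroˡ _))

    module _ (t s : ℕ) .{{_ : NonZero s}} where

      geoTail-small : ∀ {x} → x ≤ t → geoTail t s x ≈ 𝟘
      geoTail-small {x} x≤t with suc t ≤? x
      ... | yes t<x = contradiction t<x (≤⇒≯ x≤t)
      ... | no  _   = ≈-refl

      geoTail-big : ∀ {x} → t < x → geoTail t s x ≈ X (s * x)
      geoTail-big {x} t<x with suc t ≤? x
      ... | yes _   = ≈-refl
      ... | no  t≮x = contradiction t<x t≮x

      geoTail-partial : ∀ m → ∑ (geoTail t s) (m + suc t) ≈ X (s * suc t) ⊗ ∑ (λ x → X (s * x)) m
      geoTail-partial zero = begin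
        ∑ (geoTail t s) t ⊕ geoTail t s (suc t)
          ≈⟨ +-cong (∑-vanish _ t (λ _ → geoTail-small)) (geoTail-big ≤-refl) ⟩
        𝟘 ⊕ X (s * suc t)
          ≈⟨ solve 1 (λ a → con ℤ.0ℤ :+ a := a :* :1) ≈-refl _ ⟩
        X (s * suc t) ⊗ 𝟙
          ≈⟨ *-congˡ (≈-trans (X-cong (*-zeroʳ s)) X-0) ⟨
        X (s * suc t) ⊗ X (s * 0) ∎
      geoTail-partial (suc m) = begin
        ∑ (geoTail t s) (m + suc t) ⊕ geoTail t s (suc m + suc t)
          ≈⟨ +-cong (geoTail-partial m)
               (≈-trans (geoTail-big (m≤n+m (suc t) (suc m)))
                 (X-split (s * suc t) (s * suc m)
                   (≡.trans (cong (s *_) (+-comm (suc m) (suc t))) (*-distribˡ-+ s (suc t) (suc m))))) ⟩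
        X (s * suc t) ⊗ ∑ (λ x → X (s * x)) m ⊕ X (s * suc t) ⊗ X (s * suc m)
          ≈⟨ solve 3 (λ a b c → a :* b :+ a :* c := a :* (b :+ c)) ≈-refl _ _ _ ⟩
        X (s * suc t) ⊗ (∑ (λ x → X (s * x)) m ⊕ X (s * suc m)) ∎

      -- Prolonging the sum to N + t + 1 changes nothing modulo q^(N+1) and avoids a case
      -- distinction on whether t exceeds N.
      ∑-geoTail : ∑ (geoTail t s) N ≈ X (s * suc t) ⊗ geo s
      ∑-geoTail = begin
        ∑ (geoTail t s) N                       ≈⟨ ∑-truncate (geoTail t s) vanish (m≤m+n N (suc t)) ⟨
        ∑ (geoTail t s) (N + suc t)             ≈⟨ geoTail-partial N ⟩
        X (s * suc t) ⊗ ∑ (λ x → X (s * x)) N   ≈⟨ *-congˡ (geo-≈-∑ N s) ⟨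
        X (s * suc t) ⊗ geo s                   ∎
        where
        vanish : ∀ x → N < x → geoTail t s x ≈ 𝟘
        vanish x N<x with suc t ≤? x
        ... | yes _ = X-vanish (<-≤-trans N<x (m≤n*m x s))
        ... | no  _ = ≈-refl

      -- Splits off the multiplicity x of the part s when it must satisfy x = 0 or x > t.
      boxSeries-∷ : ∀ {l} {v : Vec ℕ (suc l) → ℕ} {v₀ v₁ : Vec ℕ l → ℕ} →
        (∀ c → v (0 ∷ c) ≡ v₀ c) →
        (∀ x c → x < t → v (suc x ∷ c) ≡ 0) →
        (∀ x c → t ≤ x → v (suc x ∷ c) ≡ v₁ c) →
        boxSeries N v s ≈ boxSeries N v₀ (suc s) ⊕ X (s * suc t) ⊗ geo s ⊗ boxSeries N v₁ (suc s)
      boxSeries-∷ {v = v} {v₀} {v₁} v≡v₀ v≡0 v≡v₁ = begin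
        boxSeries N v s
          ≈⟨ boxSeries-suc v s ⟩
        ∑ (λ x → X (s * x) ⊗ boxSeries N (v ∘ (x ∷_)) (suc s)) N
          ≈⟨ ∑-cong split N ⟩
        ∑ (λ x → first x ⊕ geoTail t s x ⊗ boxSeries N v₁ (suc s)) N
          ≈⟨ ∑-⊕ first _ N ⟩
        ∑ first N ⊕ ∑ (λ x → geoTail t s x ⊗ boxSeries N v₁ (suc s)) N
          ≈⟨ +-cong (∑-truncate first {m = N} (λ { (suc _) _ → ≈-refl }) z≤n)
               (≈-trans (∑-⊗ʳ (geoTail t s) (boxSeries N v₁ (suc s)) N) (*-congʳ ∑-geoTail)) ⟩
        boxSeries N v₀ (suc s) ⊕ X (s * suc t) ⊗ geo s ⊗ boxSeries N v₁ (suc s) ∎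
        where
        first : ℕ → Series
        first zero    = boxSeries N v₀ (suc s)
        first (suc _) = 𝟘

        split : ∀ x → X (s * x) ⊗ boxSeries N (v ∘ (x ∷_)) (suc s)
                        ≈ first x ⊕ geoTail t s x ⊗ boxSeries N v₁ (suc s)
        split zero = begin
          X (s * 0) ⊗ boxSeries N (v ∘ (0 ∷_)) (suc s)
            ≈⟨ *-cong (≈-trans (X-cong (*-zeroʳ s)) X-0) (boxSeries-cong v≡v₀ (suc s)) ⟩
          𝟙 ⊗ first 0
            ≈⟨ solve 2 (λ a b → :1 :* a := a :+ con ℤ.0ℤ :* b) ≈-refl (first 0) _ ⟩
          first 0 ⊕ 𝟘 ⊗ boxSeries N v₁ (suc s) ∎
        split (suc x) with ≤-<-connex t x
        ... | inj₁ t≤x = ≈-trans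
          (*-cong (≈-sym (geoTail-big (s≤s t≤x))) (boxSeries-cong (λ c → v≡v₁ x c t≤x) (suc s)))
          (≈-sym (⊕-identityˡ _))
        ... | inj₂ x<t = begin
          X (s * suc x) ⊗ boxSeries N (v ∘ (suc x ∷_)) (suc s)  ≈⟨ *-congˡ (boxSeries-0 (λ c → v≡0 x c x<t) (suc s)) ⟩
          X (s * suc x) ⊗ 𝟘                                     ≈⟨ solve 2 (λ a b → a :* con ℤ.0ℤ := con ℤ.0ℤ :+ con ℤ.0ℤ :* b)
                                                                     ≈-refl _ _ ⟩
          𝟘 ⊕ 𝟘 ⊗ boxSeries N v₁ (suc s)                        ≈⟨ +-congˡ (*-congʳ (geoTail-small x<t)) ⟨
          𝟘 ⊕ geoTail t s (suc x) ⊗ boxSeries N v₁ (suc s)      ∎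

    ∏from-suc : ∀ f s l → ∏from f s (suc l) ≈ f s ⊗ ∏from f (suc s) l
    ∏from-suc f s l = ≈-trans (∏-head (λ i → f (s + i)) l)
      (*-cong (≈-reflexive (cong f (+-identityʳ s)))
        (∏-cong (λ i → ≈-reflexive (cong f (+-suc s i))) l))

    boxSeries-1 : ∀ l s .{{_ : NonZero s}} → boxSeries {l} N (λ _ → 1) s ≈ ∏from geo s l
    boxSeries-1 zero    s = boxSeries-[] _ s
    boxSeries-1 (suc l) s = begin
      boxSeries N (λ _ → 1) s
        ≈⟨ boxSeries-∷ 0 s (λ _ → refl) (λ _ _ ()) (λ _ _ _ → refl) ⟩
      r ⊕ X (s * 1) ⊗ geo s ⊗ r
        ≈⟨ +-cong (≈-trans (≈-sym (⊗-identityˡ r)) (*-congʳ (≈-sym (geo-inverse s))))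
                  (*-congʳ (*-congʳ (X-cong (*-identityʳ s)))) ⟩
      (𝟙 ⊖ X s) ⊗ geo s ⊗ r ⊕ X s ⊗ geo s ⊗ r
        ≈⟨ solve 3 (λ x g r → (:1 :- x) :* g :* r :+ x :* g :* r := g :* r) ≈-refl (X s) (geo s) r ⟩
      geo s ⊗ r
        ≈⟨ *-congˡ (boxSeries-1 l (suc s)) ⟩
      geo s ⊗ ∏from geo (suc s) l
        ≈⟨ ∏from-suc geo s l ⟨
      ∏from geo s (suc l) ∎
      where
      r : Series
      r = boxSeries {l} N (λ _ → 1) (suc s)

    -- 1 + 2q^s/(1 - q^s) = (1 + q^s)/(1 - q^s): the part s is absent, or present with two choices
    -- of overlining.
    overGeo-expand : ∀ s .{{_ : NonZero s}} r → r ⊕ X (s * 1) ⊗ geo s ⊗ (C (ℤ.+ 2) ⊗ r) ≈ overGeo s ⊗ r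
    overGeo-expand s r = begin
      r ⊕ X (s * 1) ⊗ geo s ⊗ (C (ℤ.+ 2) ⊗ r)
        ≈⟨ +-cong (≈-trans (≈-sym (⊗-identityˡ r)) (*-congʳ (≈-sym (geo-inverse s))))
                  (*-congʳ (*-congʳ (X-cong (*-identityʳ s)))) ⟩
      (𝟙 ⊖ X s) ⊗ geo s ⊗ r ⊕ X s ⊗ geo s ⊗ (C (ℤ.+ 2) ⊗ r)
        ≈⟨ solve 3 (λ x g r → (:1 :- x) :* g :* r :+ x :* g :* (con (ℤ.+ 2) :* r) := (:1 :+ x) :* g :* r)
             ≈-refl (X s) (geo s) r ⟩
      overGeo s ⊗ r ∎

    boxSeries-overlinings : ∀ l s .{{_ : NonZero s}} → boxSeries {l} N overlinings s ≈ ∏from overGeo s l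
    boxSeries-overlinings zero    s = boxSeries-[] _ s
    boxSeries-overlinings (suc l) s = begin
      boxSeries N overlinings s
        ≈⟨ boxSeries-∷ 0 s (λ _ → refl) (λ _ _ ()) (λ _ _ _ → refl) ⟩
      r ⊕ X (s * 1) ⊗ geo s ⊗ boxSeries {l} N (λ c → 2 * overlinings c) (suc s)
        ≈⟨ +-congˡ (*-congˡ (boxSeries-* 2 (overlinings {l}) (suc s))) ⟩
      r ⊕ X (s * 1) ⊗ geo s ⊗ (C (ℤ.+ 2) ⊗ r)
        ≈⟨ overGeo-expand s r ⟩
      overGeo s ⊗ r
        ≈⟨ *-congˡ (boxSeries-overlinings l (suc s)) ⟩
      overGeo s ⊗ ∏from overGeo (suc s) l
        ≈⟨ ∏from-suc overGeo s l ⟨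
      ∏from overGeo s (suc l) ∎
      where
      r : Series
      r = boxSeries {l} N overlinings (suc s)

    -- If s is absent the value is s; if present, the search restarts at s+1. Splitting the constant
    -- s+1 as 1 + s, the 1 creates the new monomial q^s of `mexTail`, while the two occurrences of s
    -- recombine over 1/(1 - q^s).
    boxSeries-mexFrom : ∀ l s .{{_ : NonZero s}} →
      boxSeries {l} N (mexFrom s) s ≈ (C (ℤ.+ s) ⊕ mexTail s l) ⊗ ∏from geo s l
    boxSeries-mexFrom zero s = ≈-trans (boxSeries-[] _ s)
      (solve 1 (λ a → a := (a :+ con ℤ.0ℤ) :* :1) ≈-refl (C (ℤ.+ s)))
    boxSeries-mexFrom (suc l) s = begin
      boxSeries N (mexFrom s) s
        -- The constant weight s is written as s * 1 to fit `boxSeries-*` and `boxSeries-1`.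
        ≈⟨ boxSeries-∷ 0 s {v₀ = λ _ → s * 1} (λ _ → ≡.sym (*-identityʳ s)) (λ _ _ ()) (λ _ _ _ → refl) ⟩
      boxSeries {l} N (λ _ → s * 1) (suc s) ⊕ X (s * 1) ⊗ geo s ⊗ boxSeries {l} N (mexFrom (suc s)) (suc s)
        ≈⟨ +-cong (≈-trans (boxSeries-* s (λ _ → 1) (suc s)) (*-congˡ (boxSeries-1 l (suc s))))
                  (*-cong (*-congʳ (X-cong (*-identityʳ s))) (boxSeries-mexFrom l (suc s))) ⟩
      S ⊗ G ⊕ x ⊗ g ⊗ ((C (ℤ.+ suc s) ⊕ h) ⊗ G)
        ≈⟨ +-cong (≈-trans (≈-sym (⊗-identityʳ _)) (*-congˡ (≈-sym (geo-inverse s))))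
                  (*-congˡ (*-congʳ (+-congʳ (C-+ (ℤ.+ 1) (ℤ.+ s))))) ⟩
      S ⊗ G ⊗ ((𝟙 ⊖ x) ⊗ g) ⊕ x ⊗ g ⊗ ((𝟙 ⊕ S ⊕ h) ⊗ G)
        ≈⟨ solve 5 (λ S G x g h →
             S :* G :* ((:1 :- x) :* g) :+ x :* g :* ((:1 :+ S :+ h) :* G)
             := (S :+ x :* (:1 :+ h)) :* (g :* G)) ≈-refl S G x g h ⟩
      (S ⊕ x ⊗ (𝟙 ⊕ h)) ⊗ (g ⊗ G)
        ≈⟨ *-congˡ (∏from-suc geo s l) ⟨
      (S ⊕ mexTail s (suc l)) ⊗ ∏from geo s (suc l) ∎
      where
      S G x g h : Series
      S = C (ℤ.+ s)
      G = ∏from geo (suc s) l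
      x = X s
      g = geo s
      h = mexTail (suc s) l

    -- The induction on l needs an arbitrary s: the factor q^(1+⋯+s) completes the exponents (s+1) +
    -- ⋯ + (s+1+m) of `mexTail` to triangular numbers.
    theta₂-mexTail : ∀ l s → theta₂ s ⊕ X (triangular s) ⊗ mexTail (suc s) l ≈ theta₂ (l + s)
    theta₂-mexTail zero    s = ≈-trans (+-congˡ (zeroʳ _)) (⊕-identityʳ _)
    theta₂-mexTail (suc l) s = begin
      theta₂ s ⊕ X (triangular s) ⊗ (X (suc s) ⊗ (𝟙 ⊕ h))
        ≈⟨ solve 4 (λ a b c h → a :+ b :* (c :* (:1 :+ h)) := a :+ c :* b :+ c :* b :* h)
             ≈-refl (theta₂ s) (X (triangular s)) (X (suc s)) h ⟩
      theta₂ s ⊕ X (suc s) ⊗ X (triangular s) ⊕ X (suc s) ⊗ X (triangular s) ⊗ h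
        ≈⟨ +-cong (+-congˡ y≈) (*-congʳ y≈) ⟨
      theta₂ (suc s) ⊕ X (triangular (suc s)) ⊗ h
        ≈⟨ theta₂-mexTail l (suc s) ⟩
      theta₂ (l + suc s)
        ≡⟨ cong theta₂ (+-suc l s) ⟩
      theta₂ (suc l + s) ∎
      where
      h : Series
      h = mexTail (suc (suc s)) l
      y≈ : X (triangular (suc s)) ≈ X (suc s) ⊗ X (triangular s)
      y≈ = X-+ (suc s) (triangular s)

    boxSeries-mex : ∀ l → boxSeries {l} N mex 1 ≈ theta₂ l ⊗ ∏from geo 1 l
    boxSeries-mex l = ≈-trans (boxSeries-mexFrom l 1) (*-congʳ (begin
      𝟙 ⊕ h                        ≈⟨ solve 1 (λ h → :1 :+ h := :1 :+ :1 :* h) ≈-refl h ⟩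
      𝟙 ⊕ 𝟙 ⊗ h                    ≈⟨ +-cong X-0 (*-congʳ X-0) ⟨
      X 0 ⊕ X 0 ⊗ h                ≈⟨ theta₂-mexTail l 0 ⟩
      theta₂ (l + 0)               ≡⟨ cong theta₂ (+-identityʳ l) ⟩
      theta₂ l                     ∎))
      where
      h : Series
      h = mexTail 1 l

    overAbove : ℕ → ℕ → ℕ → Series
    overAbove k s l = boxSeries {l} N (overlinings-if k s) s

    overAbove-≤ : ∀ {k s l} .{{_ : NonZero s}} → s ≤ k → overAbove k s (suc l) ≈ overGeo s ⊗ overAbove k (suc s) l
    overAbove-≤ {k} {s} {l} s≤k = begin
      overAbove k s (suc l)
        ≈⟨ boxSeries-∷ 0 s zero-case (λ _ _ ()) (λ x c _ → suc-case x c) ⟩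
      r ⊕ X (s * 1) ⊗ geo s ⊗ boxSeries {l} N (λ c → 2 * overlinings-if k (suc s) c) (suc s)
        ≈⟨ +-congˡ (*-congˡ (boxSeries-* 2 (overlinings-if {l} k (suc s)) (suc s))) ⟩
      r ⊕ X (s * 1) ⊗ geo s ⊗ (C (ℤ.+ 2) ⊗ r)
        ≈⟨ overGeo-expand s r ⟩
      overGeo s ⊗ r ∎
      where
      r : Series
      r = overAbove k (suc s) l
      zero-case : ∀ c → overlinings-if k s (0 ∷ c) ≡ overlinings-if k (suc s) c
      zero-case c rewrite Equivalence.to T-≡ (≤⇒≤ᵇ s≤k) = refl
      suc-case : ∀ x c → overlinings-if k s (suc x ∷ c) ≡ 2 * overlinings-if k (suc s) c
      suc-case x c rewrite Equivalence.to T-≡ (≤⇒≤ᵇ s≤k) with firstAboveCond k (suc s) c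
      ... | true  = refl
      ... | false = refl

    -- Beyond k the first part present decides. If s is absent the search moves on; otherwise s
    -- needs at least k+1 copies, may be overlined or not, and leaves all later parts free.
    overAbove-> : ∀ {k s l} .{{_ : NonZero s}} → k < s →
      overAbove k s (suc l) ≈ overAbove k (suc s) l ⊕ X (s * suc k) ⊗ geo s ⊗ (C (ℤ.+ 2) ⊗ ∏from overGeo (suc s) l)
    overAbove-> {k} {s} {l} k<s = ≈-trans
      (boxSeries-∷ k s zero-case small-case big-case)
      (+-congˡ (*-congˡ (≈-trans (boxSeries-* 2 (overlinings {l}) (suc s)) (*-congˡ (boxSeries-overlinings l (suc s))))))
      where
      zero-case : ∀ c → overlinings-if k s (0 ∷ c) ≡ overlinings-if k (suc s) c
      zero-case c rewrite ≰ᵇ k<s = refl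
      small-case : ∀ x c → x < k → overlinings-if k s (suc x ∷ c) ≡ 0
      small-case x c x<k rewrite ≰ᵇ k<s | ≰ᵇ (s≤s x<k) = refl
      big-case : ∀ x c → k ≤ x → overlinings-if k s (suc x ∷ c) ≡ 2 * overlinings c
      big-case x c k≤x rewrite ≰ᵇ k<s | Equivalence.to T-≡ (≤⇒≤ᵇ (s≤s k≤x)) = refl

  -- The recurrence in k for overpartitions with a frequent first large part.

  ∏overGeo ∏even : ℕ → Series
  ∏overGeo = ∏from overGeo 1
  ∏even    = ∏ evenFactor

  -- Gauss's series for 1/G cut at |j| ≤ k, with j and -j merged. Up to sign, `MbarSeries k` is the
  -- error of this truncation multiplied by G.
  theta : ℕ → Series
  theta zero    = 𝟙
  theta (suc k) = theta k ⊕ C (ℤ.+ 2) ⊗ (ε (suc k) ⊗ X (suc k * suc k))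

  σmexSeries : Series
  σmexSeries n = ℤ.+ σmex n

  MbarSeries : ℕ → Series
  MbarSeries k n = ℤ.+ Mbar k n

  module OverAbove (N : ℕ) where
    open Trunc N
    open Lemmas N
    open Geometric N
    open Boxes N

    overAbove-[] : ∀ k s → overAbove k s 0 ≈ 𝟘
    overAbove-[] k s = boxSeries-[] (overlinings-if k s) s

    -- With G s = ∏from overGeo s, a first large part s contributes 2 (q^(sk) G s - q^((s+1)k) G (s+1)),
    -- so the sum over s telescopes.
    overAbove->-pair : ∀ {k s} l .{{_ : NonZero s}} → suc k < s →
      (𝟙 ⊕ X (suc k)) ⊗ overAbove (suc k) s l ⊕ (𝟙 ⊖ X (suc k)) ⊗ overAbove k s l
        ≈ C (ℤ.+ 2) ⊗ (X (s * suc k) ⊗ ∏from overGeo s l ⊖ X ((s + l) * suc k))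
    overAbove->-pair {k} {s} zero k<s = begin
      (𝟙 ⊕ y) ⊗ overAbove (suc k) s 0 ⊕ (𝟙 ⊖ y) ⊗ overAbove k s 0
        ≈⟨ +-cong (*-congˡ (overAbove-[] (suc k) s)) (*-congˡ (overAbove-[] k s)) ⟩
      (𝟙 ⊕ y) ⊗ 𝟘 ⊕ (𝟙 ⊖ y) ⊗ 𝟘
        ≈⟨ solve 2 (λ y b → (:1 :+ y) :* con ℤ.0ℤ :+ (:1 :- y) :* con ℤ.0ℤ := con (ℤ.+ 2) :* (b :* :1 :- b))
             ≈-refl y (X (s * suc k)) ⟩
      C (ℤ.+ 2) ⊗ (X (s * suc k) ⊗ 𝟙 ⊖ X (s * suc k))
        ≈⟨ *-congˡ (+-congˡ (-‿cong (X-cong (cong (_* suc k) (≡.sym (+-identityʳ s)))))) ⟩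
      C (ℤ.+ 2) ⊗ (X (s * suc k) ⊗ 𝟙 ⊖ X ((s + 0) * suc k)) ∎
      where
      y : Series
      y = X (suc k)
    overAbove->-pair {k} {s} (suc l) k<s = begin
      (𝟙 ⊕ y) ⊗ overAbove (suc k) s (suc l) ⊕ (𝟙 ⊖ y) ⊗ overAbove k s (suc l)
        ≈⟨ +-cong (*-congˡ (≈-trans (overAbove-> k<s)
                               (+-congˡ (*-congʳ (*-congʳ (X-split s (s * suc k) (*-suc s (suc k))))))))
                  (*-congˡ (overAbove-> (<-trans (n<1+n k) k<s))) ⟩
      (𝟙 ⊕ y) ⊗ (t ⊕ x ⊗ b ⊗ g ⊗ (c2 ⊗ o)) ⊕ (𝟙 ⊖ y) ⊗ (t′ ⊕ b ⊗ g ⊗ (c2 ⊗ o))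
        -- Uses (1 + y)x + (1 - y) = (1 + x) - y(1 - x) with x = q^s: the first piece completes
        -- `overGeo s`, the second cancels the denominator 1 - x.
        ≈⟨ solve 7 (λ y t t′ x b g o →
             (:1 :+ y) :* (t :+ x :* b :* g :* (con (ℤ.+ 2) :* o)) :+ (:1 :- y) :* (t′ :+ b :* g :* (con (ℤ.+ 2) :* o))
             := (:1 :+ y) :* t :+ (:1 :- y) :* t′
                :+ con (ℤ.+ 2) :* (((:1 :+ x) :* g :* o :- y :* ((:1 :- x) :* g) :* o) :* b)) ≈-refl y t t′ x b g o ⟩
      (𝟙 ⊕ y) ⊗ t ⊕ (𝟙 ⊖ y) ⊗ t′ ⊕ c2 ⊗ ((overGeo s ⊗ o ⊖ y ⊗ ((𝟙 ⊖ x) ⊗ g) ⊗ o) ⊗ b)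
        ≈⟨ +-cong (overAbove->-pair l (<-trans k<s (n<1+n s)))
                  (*-congˡ (*-congʳ (+-cong (≈-sym (∏from-suc overGeo s l))
                                            (-‿cong (*-congʳ (*-congˡ (geo-inverse s))))))) ⟩
      c2 ⊗ (X (suc s * suc k) ⊗ o ⊖ X ((suc s + l) * suc k)) ⊕ c2 ⊗ ((o′ ⊖ y ⊗ 𝟙 ⊗ o) ⊗ b)
        ≈⟨ +-congʳ (*-congˡ (+-cong (*-congʳ (X-+ (suc k) (s * suc k)))
             (-‿cong (X-cong (cong (_* suc k) (≡.sym (+-suc s l))))))) ⟩
      c2 ⊗ (y ⊗ b ⊗ o ⊖ z) ⊕ c2 ⊗ ((o′ ⊖ y ⊗ 𝟙 ⊗ o) ⊗ b)
        ≈⟨ solve 5 (λ y b o z o′ →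
             con (ℤ.+ 2) :* (y :* b :* o :- z) :+ con (ℤ.+ 2) :* ((o′ :- y :* :1 :* o) :* b)
             := con (ℤ.+ 2) :* (b :* o′ :- z)) ≈-refl y b o z o′ ⟩
      c2 ⊗ (b ⊗ o′ ⊖ z) ∎
      where
      c2 y t t′ x b g o o′ z : Series
      c2 = C (ℤ.+ 2)
      y  = X (suc k)
      t  = overAbove (suc k) (suc s) l
      t′ = overAbove k (suc s) l
      x  = X s
      b  = X (s * suc k)
      g  = geo s
      o  = ∏from overGeo (suc s) l
      o′ = ∏from overGeo s (suc l)
      z  = X ((s + suc l) * suc k)

    -- Parts below k+1 are free in both counts and factor out, which reduces everything to s = k+1.
    -- The equation s + l ≡ suc N says that the box holds all parts from s to N, so the boundary
    -- term q^((s+l)(k+1)) of the telescoping vanishes.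
    overAbove-pair : ∀ {k s} l .{{_ : NonZero s}} → s ≤ suc k → s + l ≡ suc N →
      overAbove (suc k) s l ⊕ overAbove k s l ≈ C (ℤ.+ 2) ⊗ X (suc k * suc k) ⊗ ∏from overGeo s l
    overAbove-pair {k} {s} zero s≤k s≡ = begin
      overAbove (suc k) s 0 ⊕ overAbove k s 0     ≈⟨ +-cong (overAbove-[] (suc k) s) (overAbove-[] k s) ⟩
      𝟘 ⊕ 𝟘                                       ≈⟨ solve 0 (con ℤ.0ℤ :+ con ℤ.0ℤ := con (ℤ.+ 2) :* con ℤ.0ℤ :* :1) ≈-refl ⟩
      C (ℤ.+ 2) ⊗ 𝟘 ⊗ 𝟙                           ≈⟨ *-congʳ (*-congˡ (X-vanish N<k²)) ⟨
      C (ℤ.+ 2) ⊗ X (suc k * suc k) ⊗ 𝟙           ∎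
      where
      -- The parts ran out before k+1 was reached, so N ≤ k and the right-hand side vanishes as
      -- well.
      N<k² : N < suc k * suc k
      N<k² = ≤-trans (≤-trans (≤-reflexive (≡.trans (≡.sym s≡) (+-identityʳ s))) s≤k) (m≤n*m (suc k) (suc k))
    overAbove-pair {k} {s} (suc l) s≤k s≡ with m≤n⇒m<n∨m≡n s≤k
    ... | inj₁ (s≤s s≤k′) = begin
      overAbove (suc k) s (suc l) ⊕ overAbove k s (suc l)
        ≈⟨ +-cong (overAbove-≤ s≤k) (overAbove-≤ s≤k′) ⟩
      overGeo s ⊗ overAbove (suc k) (suc s) l ⊕ overGeo s ⊗ overAbove k (suc s) l
        ≈⟨ solve 3 (λ a b c → a :* b :+ a :* c := a :* (b :+ c)) ≈-refl (overGeo s) _ _ ⟩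
      overGeo s ⊗ (overAbove (suc k) (suc s) l ⊕ overAbove k (suc s) l)
        ≈⟨ *-congˡ (overAbove-pair l (s≤s s≤k′) (≡.trans (≡.sym (+-suc s l)) s≡)) ⟩
      overGeo s ⊗ (C (ℤ.+ 2) ⊗ X (suc k * suc k) ⊗ ∏from overGeo (suc s) l)
        ≈⟨ solve 4 (λ a b c d → a :* (b :* c :* d) := b :* c :* (a :* d)) ≈-refl (overGeo s) _ _ _ ⟩
      C (ℤ.+ 2) ⊗ X (suc k * suc k) ⊗ (overGeo s ⊗ ∏from overGeo (suc s) l)
        ≈⟨ *-congˡ (∏from-suc overGeo s l) ⟨
      C (ℤ.+ 2) ⊗ X (suc k * suc k) ⊗ ∏from overGeo s (suc l) ∎
    -- The part k+1 is free in the first count but may be the first large part in the second.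
    -- Writing `t′` as (1 - y) g `t′` produces the weights 1 + y and 1 - y over the common factor
    -- `g`.
    ... | inj₂ refl = begin
      overAbove (suc k) (suc k) (suc l) ⊕ overAbove k (suc k) (suc l)
        ≈⟨ +-cong (overAbove-≤ ≤-refl) (≈-trans (overAbove-> ≤-refl) (+-congʳ (≈-trans (≈-sym (⊗-identityˡ t′))
             (*-congʳ (≈-sym (geo-inverse (suc k))))))) ⟩
      (𝟙 ⊕ y) ⊗ g ⊗ t ⊕ ((𝟙 ⊖ y) ⊗ g ⊗ t′ ⊕ b ⊗ g ⊗ (c2 ⊗ o))
        ≈⟨ solve 6 (λ y g t t′ b o →
             (:1 :+ y) :* g :* t :+ ((:1 :- y) :* g :* t′ :+ b :* g :* (con (ℤ.+ 2) :* o))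
             := g :* ((:1 :+ y) :* t :+ (:1 :- y) :* t′) :+ b :* g :* (con (ℤ.+ 2) :* o)) ≈-refl y g t t′ b o ⟩
      g ⊗ ((𝟙 ⊕ y) ⊗ t ⊕ (𝟙 ⊖ y) ⊗ t′) ⊕ b ⊗ g ⊗ (c2 ⊗ o)
        ≈⟨ +-congʳ (*-congˡ (overAbove->-pair l ≤-refl)) ⟩
      g ⊗ (c2 ⊗ (X (suc (suc k) * suc k) ⊗ o ⊖ X ((suc (suc k) + l) * suc k))) ⊕ b ⊗ g ⊗ (c2 ⊗ o)
        ≈⟨ +-congʳ (*-congˡ (*-congˡ (+-cong (*-congʳ (X-+ (suc k) (suc k * suc k))) (-‿cong (X-vanish N<))))) ⟩
      g ⊗ (c2 ⊗ (y ⊗ b ⊗ o ⊖ 𝟘)) ⊕ b ⊗ g ⊗ (c2 ⊗ o)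
        ≈⟨ solve 4 (λ y g b o →
             g :* (con (ℤ.+ 2) :* (y :* b :* o :- con ℤ.0ℤ)) :+ b :* g :* (con (ℤ.+ 2) :* o)
             := con (ℤ.+ 2) :* b :* ((:1 :+ y) :* g :* o)) ≈-refl y g b o ⟩
      c2 ⊗ b ⊗ (overGeo (suc k) ⊗ o)
        ≈⟨ *-congˡ (∏from-suc overGeo (suc k) l) ⟨
      c2 ⊗ b ⊗ ∏from overGeo (suc k) (suc l) ∎
      where
      c2 y t t′ b g o : Series
      c2 = C (ℤ.+ 2)
      y  = X (suc k)
      t  = overAbove (suc k) (suc (suc k)) l
      t′ = overAbove k (suc (suc k)) l
      b  = X (suc k * suc k)
      g  = geo (suc k)
      o  = ∏from overGeo (suc (suc k)) l
      N< : N < (suc (suc k) + l) * suc k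
      N< = ≤-trans (≤-reflexive (≡.trans (≡.sym s≡) (+-suc (suc k) l))) (m≤m*n (suc (suc k) + l) (suc k))

    -- For k = 0 any part qualifies, so only the empty overpartition is excluded.
    overAbove-0 : ∀ l s .{{_ : NonZero s}} → overAbove 0 s l ≈ ∏from overGeo s l ⊖ 𝟙
    overAbove-0 zero s = ≈-trans (overAbove-[] 0 s) (solve 0 (con ℤ.0ℤ := :1 :- :1) ≈-refl)
    overAbove-0 (suc l) s = begin
      overAbove 0 s (suc l)
        ≈⟨ overAbove-> (>-nonZero⁻¹ s) ⟩
      overAbove 0 (suc s) l ⊕ X (s * 1) ⊗ geo s ⊗ (C (ℤ.+ 2) ⊗ o)
        ≈⟨ +-congʳ (overAbove-0 l (suc s)) ⟩
      o ⊖ 𝟙 ⊕ X (s * 1) ⊗ geo s ⊗ (C (ℤ.+ 2) ⊗ o)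
        ≈⟨ solve 2 (λ o a → o :- :1 :+ a := o :+ a :- :1) ≈-refl o _ ⟩
      o ⊕ X (s * 1) ⊗ geo s ⊗ (C (ℤ.+ 2) ⊗ o) ⊖ 𝟙
        ≈⟨ +-congʳ (≈-trans (overGeo-expand s o) (≈-sym (∏from-suc overGeo s l))) ⟩
      ∏from overGeo s (suc l) ⊖ 𝟙 ∎
      where
      o : Series
      o = ∏from overGeo (suc s) l

  -- Coefficients of box series as counts of partitions and overpartitions.

  coeff-∑ₗ : ∀ {A : Set} (v w : A → ℕ) m xs →
    ∑ₗ (λ c → C (ℤ.+ v c) ⊗ X (w c)) xs m ≡ ℤ.+ sumℕ (map v (filterᵇ (λ c → w c ≡ᵇ m) xs))
  coeff-∑ₗ v w m []       = coeff-C0 m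
  coeff-∑ₗ v w m (x ∷ xs)
    rewrite coeff-⊕ (C (ℤ.+ v x) ⊗ X (w x)) (∑ₗ (λ c → C (ℤ.+ v c) ⊗ X (w c)) xs) m
          | coeff-∑ₗ v w m xs | coeff-C⊗ (ℤ.+ v x) (X (w x)) m | coeff-X (w x) m
    with w x ≡ᵇ m
  ... | true  = cong (ℤ._+ _) (ℤₚ.*-identityʳ (ℤ.+ v x))
  ... | false = ≡.trans (cong (ℤ._+ _) (ℤₚ.*-zeroʳ (ℤ.+ v x))) (ℤₚ.+-identityˡ _)

  opaque
    unfolding boxSeries

    -- Number of part sizes, cap and weight are all m, as in `partitions m`; this diagonal forces a
    -- separate box for every coefficient.
    coeff-boxSeries : ∀ m (v : Vec ℕ m → ℕ) → boxSeries m v 1 m ≡ ℤ.+ sumℕ (map v (partitions m))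
    coeff-boxSeries m v = coeff-∑ₗ v (wt 1) m (box m m)

  count : ∀ {A : Set} → (A → Bool) → List A → ℕ
  count p xs = length (filterᵇ p xs)

  module _ {A : Set} (p : A → Bool) where

    count-++ : ∀ xs ys → count p (xs ++ ys) ≡ count p xs + count p ys
    count-++ []       ys = refl
    count-++ (x ∷ xs) ys with p x
    ... | true  = cong suc (count-++ xs ys)
    ... | false = count-++ xs ys

    count-map : ∀ {B : Set} (f : B → A) xs → count p (map f xs) ≡ count (p ∘ f) xs
    count-map f []       = refl
    count-map f (x ∷ xs) with p (f x)
    ... | true  = cong suc (count-map f xs)
    ... | false = count-map f xs

  count-const : ∀ {A : Set} b (xs : List A) → count (λ _ → b) xs ≡ (if b then length xs else 0)
  count-const true  []       = refl
  count-const false []       = refl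
  count-const true  (x ∷ xs) = cong suc (count-const true xs)
  count-const false (x ∷ xs) = count-const false xs

  count-compatible : ∀ {l} (c : Vec ℕ l) → count (compatible c) (bools l) ≡ overlinings c
  count-compatible [] = refl
  count-compatible {suc l} (x ∷ c)
    rewrite count-++ (compatible (x ∷ c)) (map (true ∷_) (bools l)) (map (false ∷_) (bools l) ++ [])
          | count-++ (compatible (x ∷ c)) (map (false ∷_) (bools l)) []
          | count-map (compatible (x ∷ c)) (true ∷_) (bools l)
          | count-map (compatible (x ∷ c)) (false ∷_) (bools l) = go x
    where
    go : ∀ x → count (compatible (x ∷ c) ∘ (true ∷_)) (bools l) + (count (compatible (x ∷ c) ∘ (false ∷_)) (bools l) + 0)
               ≡ overlinings (x ∷ c)
    go zero    rewrite count-const false (bools l) | count-compatible c = +-identityʳ _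
    go (suc _) rewrite count-compatible c = refl

  -- `Mcond` reads only the multiplicities, so it is constant on the overpartitions over a fixed
  -- partition, and these are counted by the compatible flags.
  Mbar-overlinings : ∀ k m → Mbar k m ≡ sumℕ (map (overlinings-if k 1) (partitions m))
  Mbar-overlinings k m = go (partitions m)
    where
    flagged : Vec ℕ m → List (OverPartition m)
    flagged c = map (op c) (filterᵇ (compatible c) (bools m))

    go : ∀ ps → count (Mcond k) (concatMap flagged ps) ≡ sumℕ (map (overlinings-if k 1) ps)
    go []       = refl
    go (c ∷ ps)
      rewrite count-++ (Mcond k) (flagged c) (concatMap flagged ps)
            | count-map (Mcond k) (op c) (filterᵇ (compatible c) (bools m))
            | count-const (firstAboveCond k 1 c) (filterᵇ (compatible c) (bools m))
            | count-compatible c | go ps = refl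

  coeff-overAbove : ∀ k m → boxSeries m (overlinings-if k 1) 1 m ≡ MbarSeries k m
  coeff-overAbove k m = ≡.trans (coeff-boxSeries m (overlinings-if k 1)) (cong ℤ.+_ (≡.sym (Mbar-overlinings k m)))

  -- Symmetric sums and the exponents j(3j-1).

  sumℤ-snoc : ∀ (f : ℕ → ℤ) (h : ℕ → ℕ) n → sumℤ (map f (applyUpTo h (suc n))) ≡ sumℤ (map f (applyUpTo h n)) ℤ.+ f (h n)
  sumℤ-snoc f h zero    = ℤₚ.+-comm (f (h 0)) ℤ.0ℤ
  sumℤ-snoc f h (suc n) = ≡.trans (cong (ℤ._+_ (f (h 0))) (sumℤ-snoc f (h ∘ suc) n))
    (≡.sym (ℤₚ.+-assoc (f (h 0)) _ _))

  sumℤ-applyUpTo-cong : ∀ (f g : ℕ → ℤ) h k → (∀ i → f (h i) ≡ g (k i)) → ∀ n →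
    sumℤ (map f (applyUpTo h n)) ≡ sumℤ (map g (applyUpTo k n))
  sumℤ-applyUpTo-cong f g h k p zero    = refl
  sumℤ-applyUpTo-cong f g h k p (suc n) =
    cong₂ ℤ._+_ (p 0) (sumℤ-applyUpTo-cong f g (h ∘ suc) (k ∘ suc) (p ∘ suc) n)

  sumSym-cong : ∀ B {f g : ℤ → ℤ} → (∀ j → f j ≡ g j) → sumSym B f ≡ sumSym B g
  sumSym-cong B {f} {g} p = sumℤ-applyUpTo-cong
    (λ i → f (ℤ.+ i ℤ.- ℤ.+ B)) (λ i → g (ℤ.+ i ℤ.- ℤ.+ B)) id id (λ i → p (ℤ.+ i ℤ.- ℤ.+ B)) (suc (B + B))

  -- Widening the window adds its two outer values, the same recursion as that of `pentSum`.
  sumSym-suc : ∀ B f → sumSym (suc B) f ≡ sumSym B f ℤ.+ (f (ℤ.+ suc B) ℤ.+ f ℤ.-[1+ B ])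
  sumSym-suc B f = begin
    sumℤ (map g (upTo (suc (suc B + suc B))))
      ≡⟨ cong (λ m → sumℤ (map g (upTo (suc (suc m))))) (+-suc B B) ⟩
    f ℤ.-[1+ B ] ℤ.+ sumℤ (map g (applyUpTo suc (suc (suc (B + B)))))
      ≡⟨ cong (ℤ._+_ (f ℤ.-[1+ B ])) (sumℤ-snoc g suc (suc (B + B))) ⟩
    f ℤ.-[1+ B ] ℤ.+ (sumℤ (map g (applyUpTo suc (suc (B + B)))) ℤ.+ g (suc (suc (B + B))))
      ≡⟨ cong₂ (λ a b → f ℤ.-[1+ B ] ℤ.+ (a ℤ.+ b))
           (sumℤ-applyUpTo-cong g (λ i → f (ℤ.+ i ℤ.- ℤ.+ B)) suc id (λ i → cong f (shift (ℤ.+ i) (ℤ.+ B))) (suc (B + B)))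
           (cong f (top (ℤ.+ B))) ⟩
    f ℤ.-[1+ B ] ℤ.+ (sumSym B f ℤ.+ f (ℤ.+ suc B))
      ≡⟨ rotate (f ℤ.-[1+ B ]) (sumSym B f) (f (ℤ.+ suc B)) ⟩
    sumSym B f ℤ.+ (f (ℤ.+ suc B) ℤ.+ f ℤ.-[1+ B ]) ∎
    where
    open ≡.≡-Reasoning
    g : ℕ → ℤ
    g i = f (ℤ.+ i ℤ.- ℤ.+ suc B)
    shift : ∀ i b → (ℤ.1ℤ ℤ.+ i) ℤ.- (ℤ.1ℤ ℤ.+ b) ≡ i ℤ.- b
    shift = ℤ-solve-∀
    top : ∀ b → (ℤ.+ 2 ℤ.+ (b ℤ.+ b)) ℤ.- (ℤ.1ℤ ℤ.+ b) ≡ ℤ.1ℤ ℤ.+ b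
    top = ℤ-solve-∀
    rotate : ∀ a b c → a ℤ.+ (b ℤ.+ c) ≡ b ℤ.+ (c ℤ.+ a)
    rotate = ℤ-solve-∀

  pent2-pos : ∀ n → pent2 (ℤ.+ suc n) ≡ ℤ.+ (suc n * (3 * n + 2))
  pent2-pos n = ≡.trans (expand (ℤ.+ n)) (≡.sym (≡.trans (ℤₚ.pos-* (suc n) (3 * n + 2))
    (cong (λ z → ℤ.+ suc n ℤ.* (z ℤ.+ ℤ.+ 2)) (ℤₚ.pos-* 3 n))))
    where
    expand : ∀ n → (ℤ.1ℤ ℤ.+ n) ℤ.* (ℤ.+ 3 ℤ.* (ℤ.1ℤ ℤ.+ n) ℤ.- ℤ.+ 1) ≡ (ℤ.1ℤ ℤ.+ n) ℤ.* (ℤ.+ 3 ℤ.* n ℤ.+ ℤ.+ 2)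
    expand = ℤ-solve-∀

  pent2-neg : ∀ n → pent2 ℤ.-[1+ n ] ≡ ℤ.+ (suc n * (3 * n + 4))
  pent2-neg n = ≡.trans (expand (ℤ.+ n)) (≡.sym (≡.trans (ℤₚ.pos-* (suc n) (3 * n + 4))
    (cong (λ z → ℤ.+ suc n ℤ.* (z ℤ.+ ℤ.+ 4)) (ℤₚ.pos-* 3 n))))
    where
    expand : ∀ n → (ℤ.- (ℤ.1ℤ ℤ.+ n)) ℤ.* (ℤ.+ 3 ℤ.* (ℤ.- (ℤ.1ℤ ℤ.+ n)) ℤ.- ℤ.+ 1) ≡ (ℤ.1ℤ ℤ.+ n) ℤ.* (ℤ.+ 3 ℤ.* n ℤ.+ ℤ.+ 4)
    expand = ℤ-solve-∀

  -- j(3j-1) is never negative, so the absolute value merely makes it a natural exponent.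
  pent2-∣∣ : ∀ j → ℤ.+ ℤ.∣ pent2 j ∣ ≡ pent2 j
  pent2-∣∣ (ℤ.+ zero)    = refl
  pent2-∣∣ (ℤ.+ (suc n)) rewrite pent2-pos n = refl
  pent2-∣∣ ℤ.-[1+ n ]  rewrite pent2-neg n = refl

  -- Stability of the products under longer truncation.

  module Stable (N : ℕ) where
    open Trunc N
    open Lemmas N
    open Geometric N
    open Boxes N using (boxSeries-mex)

    overGeo≈1 : ∀ {s} .{{_ : NonZero s}} → N < s → overGeo s ≈ 𝟙
    overGeo≈1 {s} N<s = begin
      (𝟙 ⊕ X s) ⊗ geo s   ≈⟨ *-cong (+-congˡ (X-vanish N<s)) (geo-vanish s N<s) ⟩
      (𝟙 ⊕ 𝟘) ⊗ 𝟙         ≈⟨ solve 0 ((:1 :+ con ℤ.0ℤ) :* :1 := :1) ≈-refl ⟩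
      𝟙                   ∎

    ∏overGeo-stable : ∀ {n} → N ≤ n → ∏overGeo n ≈ ∏overGeo N
    ∏overGeo-stable = ∏-truncate _ (λ i N≤i → overGeo≈1 (s≤s N≤i))

    ∏even-stable : ∀ {n} → N ≤ n → ∏even n ≈ ∏even N
    ∏even-stable = ∏-truncate _ (λ i N≤i → 1⊖X≈1 (≤-trans (s≤s N≤i) (m≤n*m (suc i) 2)))

    boxSeries-mex-product : ∀ {n} → N ≤ n → boxSeries N mex 1 ≈ ∏even n ⊗ ∏overGeo n
    boxSeries-mex-product {n} N≤n = begin
      boxSeries N mex 1                              ≈⟨ boxSeries-mex N ⟩
      theta₂ N ⊗ ∏from geo 1 N                       ≈⟨ *-congʳ (Triangular.theta₂-product N) ⟩
      ∏even N ⊗ E ⊗ ∏from geo 1 N                    ≈⟨ solve 3 (λ d e g → d :* e :* g := d :* (e :* g)) ≈-refl (∏even N) E _ ⟩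
      ∏even N ⊗ (E ⊗ ∏from geo 1 N)                  ≈⟨ *-congˡ (∏-⊗ _ _ N) ⟨
      ∏even N ⊗ ∏overGeo N                           ≈⟨ *-cong (∏even-stable N≤n) (∏overGeo-stable N≤n) ⟨
      ∏even n ⊗ ∏overGeo n                           ∎
      where
      E : Series
      E = ∏ (λ i → 𝟙 ⊕ X (suc i)) N

    boxSeries-over-pair : ∀ k {n} → N ≤ n →
      boxSeries {N} N (overlinings-if (suc k) 1) 1 ⊕ boxSeries {N} N (overlinings-if k 1) 1
        ≈ C (ℤ.+ 2) ⊗ X (suc k * suc k) ⊗ ∏overGeo n
    boxSeries-over-pair k N≤n =
      ≈-trans (OverAbove.overAbove-pair N N (s≤s z≤n) refl) (*-congˡ (≈-sym (∏overGeo-stable N≤n)))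

    boxSeries-over-0 : ∀ {n} → N ≤ n → boxSeries {N} N (overlinings-if 0 1) 1 ≈ ∏overGeo n ⊖ 𝟙
    boxSeries-over-0 N≤n = ≈-trans (OverAbove.overAbove-0 N N 1) (+-congʳ (≈-sym (∏overGeo-stable N≤n)))

  -- Generating functions at a common precision, and comparison of coefficients.

  module GeneratingFunctions (N : ℕ) where
    open Trunc N

    -- The coefficient of q^m is taken from the box of size m at precision m, with the products
    -- already lengthened from m to N by stability.
    σmex-product : σmexSeries ≈ ∏even N ⊗ ∏overGeo N
    σmex-product = mk λ {m} m≤N →
      ≡.trans (≡.sym (coeff-boxSeries m mex)) (Trunc.at (Stable.boxSeries-mex-product m m≤N) ≤-refl)

    Mbar-pair : ∀ k → MbarSeries (suc k) ⊕ MbarSeries k ≈ C (ℤ.+ 2) ⊗ X (suc k * suc k) ⊗ ∏overGeo N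
    Mbar-pair k = mk λ {m} m≤N →
      ≡.trans (coeff-⊕ (MbarSeries (suc k)) (MbarSeries k) m)
      (≡.trans (≡.sym (cong₂ ℤ._+_ (coeff-overAbove (suc k) m) (coeff-overAbove k m)))
      (≡.trans (≡.sym (coeff-⊕ (boxSeries {m} m (overlinings-if (suc k) 1) 1) (boxSeries {m} m (overlinings-if k 1) 1) m))
        (Trunc.at (Stable.boxSeries-over-pair m k m≤N) ≤-refl)))

    Mbar-0 : MbarSeries 0 ≈ ∏overGeo N ⊖ 𝟙
    Mbar-0 = mk λ {m} m≤N →
      ≡.trans (≡.sym (coeff-overAbove 0 m)) (Trunc.at (Stable.boxSeries-over-0 m m≤N) ≤-refl)

    ε-square : ∀ k → ε k ⊗ ε k ≈ 𝟙
    ε-square zero    = ⊗-identityˡ 𝟙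
    ε-square (suc k) = ≈-trans (solve 1 (λ e → (:- e) :* (:- e) := e :* e) ≈-refl (ε k)) (ε-square k)

    -- After multiplication by (-1)^(k+1) the recurrence for M̄ₖ₊₁ + M̄ₖ becomes a difference
    -- equation for (-1)ᵏ M̄ₖ, whose increments are G times the increments of `theta`.
    ε⊗Mbar : ∀ k → ε k ⊗ MbarSeries k ≈ ∏overGeo N ⊗ theta k ⊖ 𝟙
    ε⊗Mbar zero = begin
      𝟙 ⊗ MbarSeries 0        ≈⟨ *-congˡ Mbar-0 ⟩
      𝟙 ⊗ (∏overGeo N ⊖ 𝟙)    ≈⟨ solve 1 (λ p → :1 :* (p :- :1) := p :* :1 :- :1) ≈-refl (∏overGeo N) ⟩
      ∏overGeo N ⊗ 𝟙 ⊖ 𝟙      ∎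
    ε⊗Mbar (suc k) = begin
      ⊝ e ⊗ M′
        ≈⟨ solve 3 (λ e m m′ → (:- e) :* m′ := e :* m :+ (:- e) :* (m′ :+ m)) ≈-refl e M M′ ⟩
      e ⊗ M ⊕ ⊝ e ⊗ (M′ ⊕ M)
        ≈⟨ +-cong (ε⊗Mbar k) (*-congˡ (Mbar-pair k)) ⟩
      p ⊗ theta k ⊖ 𝟙 ⊕ ⊝ e ⊗ (C (ℤ.+ 2) ⊗ x ⊗ p)
        ≈⟨ solve 4 (λ p t e x →
             p :* t :- :1 :+ (:- e) :* (con (ℤ.+ 2) :* x :* p)
             := p :* (t :+ con (ℤ.+ 2) :* ((:- e) :* x)) :- :1) ≈-refl p (theta k) e x ⟩
      p ⊗ theta (suc k) ⊖ 𝟙 ∎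
      where
      e M M′ p x : Series
      e  = ε k
      M  = MbarSeries k
      M′ = MbarSeries (suc k)
      p  = ∏overGeo N
      x  = X (suc k * suc k)

    truncated-theta : ∀ k → ε k ⊗ (σmexSeries ⊗ theta k ⊖ ∏even N) ≈ ∏even N ⊗ MbarSeries k
    truncated-theta k = begin
      ε k ⊗ (σmexSeries ⊗ theta k ⊖ d)        ≈⟨ *-congˡ (+-congʳ (*-congʳ σmex-product)) ⟩
      ε k ⊗ (d ⊗ p ⊗ theta k ⊖ d)             ≈⟨ solve 4 (λ e d p t → e :* (d :* p :* t :- d) := d :* (e :* (p :* t :- :1)))
                                                   ≈-refl (ε k) d p (theta k) ⟩
      d ⊗ (ε k ⊗ (p ⊗ theta k ⊖ 𝟙))           ≈⟨ *-congˡ (*-congˡ (ε⊗Mbar k)) ⟨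
      d ⊗ (ε k ⊗ (ε k ⊗ MbarSeries k))        ≈⟨ solve 3 (λ e d m → d :* (e :* (e :* m)) := (e :* e) :* (d :* m))
                                                   ≈-refl (ε k) d (MbarSeries k) ⟩
      ε k ⊗ ε k ⊗ (d ⊗ MbarSeries k)          ≈⟨ *-congʳ (ε-square k) ⟩
      𝟙 ⊗ (d ⊗ MbarSeries k)                  ≈⟨ ⊗-identityˡ _ ⟩
      d ⊗ MbarSeries k                        ∎
      where
      d p : Series
      d = ∏even N
      p = ∏overGeo N

    ε≈C : ∀ k → ε k ≈ C (sgn (ℤ.+ k))
    ε≈C zero    = ≈-refl
    ε≈C (suc k) = begin
      ⊝ ε k                      ≈⟨ -‿cong (ε≈C k) ⟩
      ⊝ C (sgn (ℤ.+ k))          ≈⟨ C-‿ _ ⟨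
      C (ℤ.- sgn (ℤ.+ k))        ≡⟨ cong C (ℤₚ.-1*i≡-i (sgn (ℤ.+ k))) ⟨
      C (sgn (ℤ.+ suc k))        ∎

    coeff-ε⊗ : ∀ k f → (ε k ⊗ f) N ≡ sgn (ℤ.+ k) ℤ.* f N
    coeff-ε⊗ k f = ≡.trans (at (*-congʳ (ε≈C k)) ≤-refl) (coeff-C⊗ (sgn (ℤ.+ k)) f N)

    coeff-⊖ : ∀ f g → (f ⊖ g) N ≡ f N ℤ.- g N
    coeff-⊖ f g = ≡.trans (coeff-⊕ f (⊝ g) N) (cong (ℤ._+_ (f N)) (coeff-⊝ g N))

    -- Multiplication by qᵃ shifts the index; `g` extends `f` by zero to negative integers, which
    -- covers a > N and matches `σmexℤ` and `Mbarℤ`.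
    coeff-X⊗ : ∀ a {f} (g : ℤ → ℤ) → (∀ m → f m ≡ g (ℤ.+ m)) → (∀ m → g ℤ.-[1+ m ] ≡ ℤ.0ℤ) →
               (X a ⊗ f) N ≡ g (ℤ.+ N ℤ.- ℤ.+ a)
    coeff-X⊗ a {f} g f≡g g≡0 with ≤-<-connex a N
    ... | inj₁ a≤N = ≡.trans (cong (X a ⊗ f) (≡.sym (m+[n∸m]≡n a≤N)))
        (≡.trans (coeff-X⊗-≥ a f (N ∸ a))
        (≡.trans (f≡g (N ∸ a)) (cong g (≡.sym (≡.trans (ℤₚ.[+m]-[+n]≡m⊖n N a) (ℤₚ.⊖-≥ a≤N))))))
    ... | inj₂ N<a = ≡.trans (coeff-X⊗-< a f N<a) (≡.sym (≡.trans (cong g eq) (g≡0 _)))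
      where
      eq : ℤ.+ N ℤ.- ℤ.+ a ≡ ℤ.-[1+ pred (a ∸ N) ]
      eq = ≡.trans (ℤₚ.[+m]-[+n]≡m⊖n N a) (≡.trans (ℤₚ.⊖-< N<a)
        (cong (λ z → ℤ.- (ℤ.+ z)) (≡.sym (suc-pred (a ∸ N) {{>-nonZero (m<n⇒0<n∸m N<a)}}))))

    coeff-σmex⊗theta : ∀ k → (σmexSeries ⊗ theta k) N
      ≡ σmexℤ (ℤ.+ N) ℤ.+ ℤ.+ 2 ℤ.* sum1to k (λ j → sgn (ℤ.+ j) ℤ.* σmexℤ (ℤ.+ N ℤ.- ℤ.+ (j * j)))
    coeff-σmex⊗theta zero = ≡.trans (at (solve 1 (λ s → s :* :1 := s) ≈-refl σmexSeries) ≤-refl)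
      (≡.sym (ℤₚ.+-identityʳ _))
    coeff-σmex⊗theta (suc k) = ≡.trans (at expand ≤-refl)
      (≡.trans (coeff-⊕ (σmexSeries ⊗ theta k) _ N)
      (≡.trans (cong₂ ℤ._+_ (coeff-σmex⊗theta k)
        (≡.trans (coeff-C⊗ (ℤ.+ 2) _ N) (cong (ℤ._*_ (ℤ.+ 2))
          (≡.trans (coeff-ε⊗ (suc k) _)
            (cong (ℤ._*_ (sgn (ℤ.+ suc k))) (coeff-X⊗ (suc k * suc k) σmexℤ (λ _ → refl) (λ _ → refl)))))))
      (≡.trans (distrib (σmexℤ (ℤ.+ N)) (sum1to k f) (f (suc k)))
        (cong (λ z → σmexℤ (ℤ.+ N) ℤ.+ ℤ.+ 2 ℤ.* z) (≡.sym (sumℤ-snoc (λ i → f (suc i)) id k))))))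
      where
      f : ℕ → ℤ
      f j = sgn (ℤ.+ j) ℤ.* σmexℤ (ℤ.+ N ℤ.- ℤ.+ (j * j))
      expand : σmexSeries ⊗ theta (suc k)
        ≈ σmexSeries ⊗ theta k ⊕ C (ℤ.+ 2) ⊗ (ε (suc k) ⊗ (X (suc k * suc k) ⊗ σmexSeries))
      expand = solve 4 (λ s t e x →
        s :* (t :+ con (ℤ.+ 2) :* (e :* x)) := s :* t :+ con (ℤ.+ 2) :* (e :* (x :* s)))
        ≈-refl σmexSeries (theta k) (ε (suc k)) (X (suc k * suc k))
      distrib : ∀ a b c → a ℤ.+ ℤ.+ 2 ℤ.* b ℤ.+ ℤ.+ 2 ℤ.* c ≡ a ℤ.+ ℤ.+ 2 ℤ.* (b ℤ.+ c)
      distrib = ℤ-solve-∀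

    -- Kept general in `f`: with `MbarSeries k` it yields the sum over j, with 𝟙 it yields δ'.
    coeff-pentSum⊗ : ∀ f B → (pentSum B ⊗ f) N ≡ sumSym B (λ j → sgn j ℤ.* (X ℤ.∣ pent2 j ∣ ⊗ f) N)
    coeff-pentSum⊗ f zero = ≡.trans
      (at (≈-trans (⊗-identityˡ f) (≈-trans (≈-sym (⊗-identityˡ f)) (*-congʳ (≈-sym X-0)))) ≤-refl)
      (≡.sym (≡.trans (ℤₚ.+-identityʳ _) (ℤₚ.*-identityˡ _)))
      where open Lemmas N
    coeff-pentSum⊗ f (suc B) = ≡.trans (at expand ≤-refl)
      (≡.trans (coeff-⊕ (pentSum B ⊗ f) _ N)
      (≡.trans (cong₂ ℤ._+_ (coeff-pentSum⊗ f B)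
        (≡.trans (coeff-⊕ _ _ N) (cong₂ ℤ._+_ (coeff-ε⊗ (suc B) _) (coeff-ε⊗ (suc B) _))))
      (≡.trans (cong₂ (λ a b → sumSym B F ℤ.+ (sgn (ℤ.+ suc B) ℤ.* (X a ⊗ f) N ℤ.+ sgn (ℤ.+ suc B) ℤ.* (X b ⊗ f) N))
          (≡.sym (cong ℤ.∣_∣ (pent2-pos B))) (≡.sym (cong ℤ.∣_∣ (pent2-neg B))))
        (≡.sym (sumSym-suc B F)))))
      where
      F : ℤ → ℤ
      F j = sgn j ℤ.* (X ℤ.∣ pent2 j ∣ ⊗ f) N
      x₁ x₂ : Series
      x₁ = X (suc B * (3 * B + 2))
      x₂ = X (suc B * (3 * B + 4))
      expand : pentSum (suc B) ⊗ f ≈ pentSum B ⊗ f ⊕ (ε (suc B) ⊗ (x₁ ⊗ f) ⊕ ε (suc B) ⊗ (x₂ ⊗ f))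
      expand = solve 5 (λ p e x₁ x₂ f → (p :+ e :* (x₁ :+ x₂)) :* f := p :* f :+ (e :* (x₁ :* f) :+ e :* (x₂ :* f)))
        ≈-refl (pentSum B) (ε (suc B)) x₁ x₂ f

    coeff-∏even⊗Mbar : ∀ k {B} → N ≤ B → (∏even N ⊗ MbarSeries k) N
      ≡ sumSym B (λ j → sgn j ℤ.* Mbarℤ k (ℤ.+ N ℤ.- pent2 j))
    coeff-∏even⊗Mbar k {B} N≤B = ≡.trans
      (at (*-congʳ (≈-sym (≈-trans (Pentagonal.pentagonal N N≤B) (Stable.∏even-stable N N≤B)))) ≤-refl)
      (≡.trans (coeff-pentSum⊗ (MbarSeries k) B) (sumSym-cong B λ j → cong (ℤ._*_ (sgn j))
        (≡.trans (coeff-X⊗ ℤ.∣ pent2 j ∣ (Mbarℤ k) (λ _ → refl) (λ _ → refl))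
          (cong (λ z → Mbarℤ k (ℤ.+ N ℤ.- z)) (pent2-∣∣ j)))))

    coeff-∏even : ∏even N N ≡ δ' N
    coeff-∏even = ≡.trans
      (at (≈-sym (≈-trans (⊗-identityʳ _) (Pentagonal.pentagonal N ≤-refl))) ≤-refl)
      (≡.trans (coeff-pentSum⊗ 𝟙 N) (sumSym-cong N λ j →
        ≡.trans (cong (ℤ._*_ (sgn j)) (at (⊗-identityʳ (X ℤ.∣ pent2 j ∣)) ≤-refl)) (indicator j)))
      where
      indicator : ∀ j → sgn j ℤ.* X ℤ.∣ pent2 j ∣ N ≡ (if ⌊ pent2 j ℤₚ.≟ ℤ.+ N ⌋ then sgn j else ℤ.+ 0)
      indicator j rewrite coeff-X ℤ.∣ pent2 j ∣ N with pent2 j ℤₚ.≟ ℤ.+ N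
      ... | yes eq rewrite eq | Equivalence.to T-≡ (≡⇒≡ᵇ N N refl) = ℤₚ.*-identityʳ _
      ... | no neq with ℤ.∣ pent2 j ∣ ≡ᵇ N in eq
      ...   | false = ℤₚ.*-zeroʳ (sgn j)
      ...   | true  = contradiction (≡.trans (≡.sym (pent2-∣∣ j)) (cong ℤ.+_ (≡ᵇ⇒≡ _ N (≡.subst T (≡.sym eq) _)))) neq

open import Data.Nat using (ℕ; _≤_)
open import Data.Integer using (ℤ; +_; _+_; _-_; _*_)
open import Data.Nat.Properties using (≤-refl)
open import Relation.Binary.PropositionalEquality using (_≡_; sym; trans; cong; cong₂)

-- The sum over all integers j is rendered by every window |j| ≤ B with B ≥ n: since |j| ≤ j(3j-1),
-- each term outside has a negative argument and is zero.
theorem3 : (k n : ℕ) → 1 ≤ k → 1 ≤ n → (B : ℕ) → n ≤ B →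
    sgn (+ k) * (σmexℤ (+ n) + (+ 2) * sum1to k (λ j → sgn (+ j) * σmexℤ (+ n - + (j Data.Nat.* j))) - δ' n)
    ≡ sumSym B (λ j → sgn j * Mbarℤ k (+ n - pent2 j))
-- Both sides are the coefficient of qⁿ in `truncated-theta k`, taken at precision N = n.
theorem3 k n _ _ B n≤B = trans
  (sym (trans (coeff-ε⊗ k _) (cong (_*_ (sgn (+ k)))
    (trans (coeff-⊖ (σmexSeries ⊗ theta k) (∏even n)) (cong₂ _-_ (coeff-σmex⊗theta k) coeff-∏even)))))
  (trans (Trunc.at (truncated-theta k) ≤-refl) (coeff-∏even⊗Mbar k n≤B))
  where
  open QSeries
  open GeneratingFunctions n
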